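{- For every integer $k \geq 8$ that is divisible by four, we have \[ f\left(n,k,\binom{k}{2} - k/2 + 1\right) = \Omega\left(n^{2 - 8/k}\right). \]
   Context: For positive integers $n,k,\ell$, $f(n,k,\ell)$ denotes the minimum size of a set of colors $C$ for which there exists a coloring $\chi:E(K_n)\to C$ of the edges of the complete graph $K_n$ such that every set of $k$ vertices of $K_n$ spans (in the induced subgraph $K_k$) edges of at least $\ell$ distinct colors. Here $k$ is a constant and the asymptotic notation refers to $n\to\infty$. -}

module Defs where

open import Data.Nat using (ℕ; _+_; _∸_; _*_; _^_; _≤_; _<_)
open import Data.Nat.DivMod using (_/_)
open import Data.Nat.Combinatorics using (_C_)
open import Data.Fin using (Fin; toℕ)
open import Data.Fin.Subset using (Subset; _∈_; ∣_∣)
open import Data.Product using (Σ; _×_; ∃-syntax)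
open import Relation.Binary.PropositionalEquality using (_≡_)

-- An edge colouring of K_n with colour set Fin c.  An edge {u,v} (u ≠ v) is
-- represented by the ordered pair (u , v) with toℕ u < toℕ v; the value of
-- χ on other pairs is irrelevant.
EdgeColouring : ℕ → ℕ → Set
EdgeColouring n c = Fin n → Fin n → Fin c

AppearsIn : ∀ {n c} → EdgeColouring n c → Subset n → Fin c → Set
AppearsIn {n} χ S j =
  ∃[ u ] ∃[ v ] (u ∈ S × v ∈ S × toℕ u < toℕ v × χ u v ≡ j)

SpansAtLeast : ∀ {n c} → EdgeColouring n c → Subset n → ℕ → Set
SpansAtLeast {n} {c} χ S ℓ =
  ∃[ T ] (ℓ ≤ ∣ T ∣ × (∀ j → j ∈ T → AppearsIn χ S j))

IsKLColouring : ∀ {n c} → ℕ → ℕ → EdgeColouring n c → Set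
IsKLColouring {n} k ℓ χ = ∀ (S : Subset n) → ∣ S ∣ ≡ k → SpansAtLeast χ S ℓ

ellThm : ℕ → ℕ
ellThm k = (k C 2 ∸ k / 2) + 1

{-# OPTIONS --safe #-}
module Submission where

-- Write k = 4m.  The colour energy graph has the pairs of vertices of K_n as vertices, with
-- (u₁,u₂) adjacent to (v₁,v₂) when the edges u₁v₁ and u₂v₂ have the same colour.  If there are c
-- colours, Cauchy–Schwarz gives it about n⁴/c edges, so some subgraph has minimum degree about
-- n²/c.  Walk in this subgraph from a fixed pair, always stepping to a pair of new points; every
-- step adds two points and one repeated colour.  Two walks of at most m steps that reach the same
-- pair from different predecessors span a set of at most 4m points with half as many repeated
-- colours, which extends by further steps to k points with k/2 repetitions.  That is excluded,
-- so walks of length m are determined by their ends, the branching is at most (n²)^(1/m), and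
-- n²/c = O(n^(2/m)).  A coincidence between points of the two walks only lowers the number of
-- points, so it need not be avoided; inside one walk few steps fail to be new because no vertex
-- has more than 2m edges of one colour.

open import Defs
open import Data.Nat using (ℕ; zero; suc; _+_; _∸_; _*_; _^_; _≤_; _<_; z≤n; s≤s; s≤s⁻¹; >-nonZero)
open import Data.Nat.Divisibility using (_∣_; divides)
open import Data.Nat.DivMod using (_/_; m*n/n≡m)
open import Data.Nat.Combinatorics using (_C_; nC1≡n; nCk+nC[k+1]≡[n+1]C[k+1])
open import Data.Nat.ListAction using (sum)
open import Data.Nat.ListAction.Properties using (sum-↭)
open import Data.Nat.Properties as ℕ using (module ≤-Reasoning)
open import Data.Nat.Solver using (module +-*-Solver)
open import Data.Fin using (Fin; zero; suc; toℕ; fromℕ<; inject≤; remQuot; combine)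
open import Data.Fin.Properties
  using (_≟_; <-cmp; suc-injective; inject≤-injective; injective⇒≤; combine-injective; combine-remQuot)
open import Data.Fin.Subset as Subset using (Subset; inside; outside; ∣_∣)
open import Data.Fin.Subset.Properties using (∉⊥; ∣⊥∣≡0)
open import Data.List.Base using (List; foldr; []; _∷_; _++_; length; lookup; map; filter; take; cartesianProduct; allFin)
open import Data.List.Properties using (length-++; length-map; length-take; length-tabulate; map-∘)
open import Data.List.Membership.Propositional using (_∈_; _∉_; find)
open import Data.List.Membership.Propositional.Properties
  using (∈-∃++; ∈-++⁺ˡ; ∈-++⁺ʳ; ∈-++⁻; ∈-map⁺; ∈-map⁻; ∈-filter⁺; ∈-filter⁻; ∈-allFin; ∈-lookup)
import Data.List.Membership.DecPropositional as DecMembership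
open import Data.List.Relation.Binary.Permutation.Propositional using (_↭_; ↭⇒↭ₛ)
open import Data.List.Relation.Binary.Permutation.Propositional.Properties
  using (map⁺; filter-↭; ↭-length; shift)
import Data.List.Relation.Binary.Permutation.Setoid.Properties as SetoidPerm
open import Data.List.Relation.Binary.Subset.Propositional using (_⊆_)
open import Data.List.Relation.Unary.All using ([]; _∷_)
import Data.List.Relation.Unary.All as All
open import Data.List.Relation.Unary.All.Properties using (¬Any⇒All¬)
open import Data.List.Relation.Unary.Any using (here; there; any?)
open import Data.List.Relation.Unary.AllPairs using ([]; _∷_)
open import Data.List.Relation.Unary.Unique.Propositional using (Unique)
open import Data.List.Relation.Unary.Unique.Propositional.Properties
  using (Unique[x∷xs]⇒x∉xs)
import Data.List.Relation.Unary.Unique.Propositional.Properties as Unique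
open import Data.Vec.Base as Vec using ([]; _∷_)
open import Data.Bool.Base using (if_then_else_)
open import Data.Product using (∃-syntax; _×_; _,_; proj₁; proj₂; swap; uncurry)
open import Data.Product.Properties using (≡-dec)
open import Data.Sum using (_⊎_; inj₁; inj₂)
open import Function using (_∘_; case_of_)
open import Relation.Binary.Definitions using (tri<; tri≈; tri>)
open import Relation.Binary.PropositionalEquality hiding (J)
open import Relation.Nullary using (¬_; Dec; yes; no; does; contradiction)
open import Relation.Nullary.Decidable using (_×-dec_; ¬?; decidable-stable)
open import Level using (0ℓ)
open import Relation.Unary using (Pred; Decidable)

private
  variable
    A B : Set
    x y : A
    xs ys : List A

-- Lists without repetition

unique-∷ : x ∉ xs → Unique xs → Unique (x ∷ xs)
unique-∷ x∉xs xs! = ¬Any⇒All¬ _ x∉xs ∷ xs!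

-- Pigeonhole: delete the head of `xs` from `ys` and induct.
unique-⊆⇒length≤ : Unique xs → xs ⊆ ys → length xs ≤ length ys
unique-⊆⇒length≤ {xs = []} _ _ = z≤n
unique-⊆⇒length≤ {xs = x ∷ xs} xs!@(_ ∷ xs'!) xs⊆ys
  with as , bs , refl ← ∈-∃++ (xs⊆ys (here refl)) = begin
  suc (length xs)          ≤⟨ s≤s (unique-⊆⇒length≤ xs'! xs⊆) ⟩
  suc (length (as ++ bs))  ≡⟨ ↭-length (shift x as bs) ⟨
  length (as ++ x ∷ bs)    ∎
  where
  open ≤-Reasoning
  xs⊆ : xs ⊆ as ++ bs
  xs⊆ y∈xs with ∈-++⁻ as (xs⊆ys (there y∈xs))
  ... | inj₁ y∈as = ∈-++⁺ˡ y∈as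
  ... | inj₂ (here refl) = contradiction y∈xs (Unique[x∷xs]⇒x∉xs xs!)
  ... | inj₂ (there y∈bs) = ∈-++⁺ʳ as y∈bs

lookup-injective : {xs : List A} → Unique xs → ∀ i j → lookup xs i ≡ lookup xs j → i ≡ j
lookup-injective (_ ∷ _)   zero    zero    _ = refl
lookup-injective (x∉ ∷ _)  zero    (suc j) e = contradiction e (All.lookup x∉ (∈-lookup j))
lookup-injective (x∉ ∷ _)  (suc i) zero    e = contradiction (sym e) (All.lookup x∉ (∈-lookup i))
lookup-injective (_ ∷ xs!) (suc i) (suc j) e = cong suc (lookup-injective xs! i j e)

length-filter-¬ : {P : Pred A 0ℓ} (P? : Decidable P) (xs : List A) →
  length (filter (¬? ∘ P?) xs) + length (filter P? xs) ≡ length xs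
length-filter-¬ P? [] = refl
length-filter-¬ P? (x ∷ xs) with P? x
... | yes _ = trans (ℕ.+-suc _ _) (cong suc (length-filter-¬ P? xs))
... | no  _ = cong suc (length-filter-¬ P? xs)

-- Finite sums

∑ : List A → (A → ℕ) → ℕ
∑ xs f = sum (map f xs)

𝟙 : {P : Set} → Dec P → ℕ
𝟙 d = if does d then 1 else 0

𝟙-yes : {P : Set} (d : Dec P) → P → 1 ≤ 𝟙 d
𝟙-yes (yes _) _ = s≤s z≤n
𝟙-yes (no ¬p) p = contradiction p ¬p

𝟙-≤ : {P : Set} (d : Dec P) {k : ℕ} → (P → 1 ≤ k) → 𝟙 d ≤ k
𝟙-≤ (yes p) f = f p
𝟙-≤ (no _)  f = z≤n

length-filter≡∑ : {P : Pred A 0ℓ} (P? : Decidable P) (xs : List A) →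
  length (filter P? xs) ≡ ∑ xs (𝟙 ∘ P?)
length-filter≡∑ P? [] = refl
length-filter≡∑ P? (x ∷ xs) with P? x
... | yes _ = cong suc (length-filter≡∑ P? xs)
... | no  _ = length-filter≡∑ P? xs

∑-mono : ∀ (xs : List A) {f g : A → ℕ} → (∀ x → f x ≤ g x) → ∑ xs f ≤ ∑ xs g
∑-mono []       _   = z≤n
∑-mono (x ∷ xs) f≤g = ℕ.+-mono-≤ (f≤g x) (∑-mono xs f≤g)

∑-cong : ∀ (xs : List A) {f g : A → ℕ} → (∀ x → f x ≡ g x) → ∑ xs f ≡ ∑ xs g
∑-cong []       _   = refl
∑-cong (x ∷ xs) f≡g = cong₂ _+_ (f≡g x) (∑-cong xs f≡g)

∑-const : ∀ (xs : List A) k → ∑ xs (λ _ → k) ≡ length xs * k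
∑-const []       k = refl
∑-const (_ ∷ xs) k = cong (k +_) (∑-const xs k)

∑-+ : ∀ (xs : List A) (f g : A → ℕ) → ∑ xs (λ x → f x + g x) ≡ ∑ xs f + ∑ xs g
∑-+ [] f g = refl
∑-+ (x ∷ xs) f g = trans (cong (f x + g x +_) (∑-+ xs f g))
  (solve 4 (λ a b c d → a :+ b :+ (c :+ d) := a :+ c :+ (b :+ d)) refl (f x) (g x) (∑ xs f) (∑ xs g))
  where open +-*-Solver

*-∑ : ∀ (xs : List A) k (f : A → ℕ) → ∑ xs (λ x → k * f x) ≡ k * ∑ xs f
*-∑ []       k f = sym (ℕ.*-zeroʳ k)
*-∑ (x ∷ xs) k f = trans (cong (k * f x +_) (*-∑ xs k f)) (sym (ℕ.*-distribˡ-+ k (f x) (∑ xs f)))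

∑-comm : ∀ (xs : List A) (ys : List B) (f : A → B → ℕ) →
  ∑ xs (λ x → ∑ ys (f x)) ≡ ∑ ys (λ y → ∑ xs (λ x → f x y))
∑-comm [] ys f = sym (trans (∑-const ys 0) (ℕ.*-zeroʳ (length ys)))
∑-comm (x ∷ xs) ys f = trans (cong (∑ ys (f x) +_) (∑-comm xs ys f)) (sym (∑-+ ys (f x) _))

∑-++ : ∀ (xs {ys} : List A) (f : A → ℕ) → ∑ (xs ++ ys) f ≡ ∑ xs f + ∑ ys f
∑-++ []       f = refl
∑-++ (x ∷ xs) f = trans (cong (f x +_) (∑-++ xs f)) (sym (ℕ.+-assoc (f x) _ _))

∑-cartesianProduct : ∀ (xs : List A) (ys : List B) (f : A × B → ℕ) →
  ∑ (cartesianProduct xs ys) f ≡ ∑ xs (λ x → ∑ ys (λ y → f (x , y)))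
∑-cartesianProduct [] ys f = refl
∑-cartesianProduct (x ∷ xs) ys f = trans (∑-++ (map (x ,_) ys) f)
  (cong₂ _+_ (cong sum (sym (map-∘ ys))) (∑-cartesianProduct xs ys f))

length-cartesianProduct : ∀ (xs : List A) (ys : List B) →
  length (cartesianProduct xs ys) ≡ length xs * length ys
length-cartesianProduct [] ys = refl
length-cartesianProduct (x ∷ xs) ys = trans (length-++ (map (x ,_) ys))
  (cong₂ _+_ (length-map (x ,_) ys) (length-cartesianProduct xs ys))

∑-↭ : ∀ {xs ys : List A} (f : A → ℕ) → xs ↭ ys → ∑ xs f ≡ ∑ ys f
∑-↭ f p = sum-↭ (map⁺ f p)

-- The Cauchy-Schwarz inequality and pairs of equal colour

2xy≤x²+y² : ∀ x y → 2 * (x * y) ≤ x * x + y * y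
2xy≤x²+y² x y with ℕ.≤-total x y
-- The larger number is the smaller one plus `d`, and the two sides differ by `d * d`.
... | inj₁ x≤y with d , refl ← ℕ.m≤n⇒∃[o]m+o≡n x≤y = ℕ.≤-trans (ℕ.m≤m+n _ (d * d)) (ℕ.≤-reflexive
  (solve 2 (λ x d → con 2 :* (x :* (x :+ d)) :+ d :* d := x :* x :+ (x :+ d) :* (x :+ d)) refl x d))
  where open +-*-Solver
... | inj₂ y≤x with d , refl ← ℕ.m≤n⇒∃[o]m+o≡n y≤x = ℕ.≤-trans (ℕ.m≤m+n _ (d * d)) (ℕ.≤-reflexive
  (solve 2 (λ y d → con 2 :* ((y :+ d) :* y) :+ d :* d := (y :+ d) :* (y :+ d) :+ y :* y) refl y d))
  where open +-*-Solver

-- Induction on the list; the cross term of the new entry `a` with the tail is bounded by adding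
-- `2ay ≤ a² + y²` over the tail.
cauchy-schwarz : ∀ (xs : List A) (f : A → ℕ) → ∑ xs f * ∑ xs f ≤ length xs * ∑ xs (λ x → f x * f x)
cauchy-schwarz [] f = z≤n
cauchy-schwarz (x ∷ xs) f = begin
  (a + s) * (a + s)
    ≡⟨ solve 2 (λ a s → (a :+ s) :* (a :+ s) := a :* a :+ con 2 :* a :* s :+ s :* s) refl a s ⟩
  a * a + 2 * a * s + s * s
    ≤⟨ ℕ.+-mono-≤ (ℕ.+-monoʳ-≤ (a * a) cross) (cauchy-schwarz xs f) ⟩
  a * a + (l * (a * a) + q) + l * q
    ≡⟨ solve 3 (λ a l q → a :+ (l :* a :+ q) :+ l :* q := (con 1 :+ l) :* (a :+ q)) refl (a * a) l q ⟩
  suc l * (a * a + q) ∎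
  where
  open ≤-Reasoning
  open +-*-Solver
  a = f x
  s = ∑ xs f
  l = length xs
  q = ∑ xs (λ x → f x * f x)
  cross : 2 * a * s ≤ l * (a * a) + q
  cross = begin
    2 * a * s                               ≡⟨ *-∑ xs (2 * a) f ⟨
    ∑ xs (λ y → 2 * a * f y)                ≤⟨ ∑-mono xs (λ y → ℕ.≤-trans (ℕ.≤-reflexive (ℕ.*-assoc 2 a (f y))) (2xy≤x²+y² a (f y))) ⟩
    ∑ xs (λ y → a * a + f y * f y)          ≡⟨ ∑-+ xs (λ _ → a * a) (λ y → f y * f y) ⟩
    ∑ xs (λ _ → a * a) + q                  ≡⟨ cong (_+ q) (∑-const xs (a * a)) ⟩
    l * (a * a) + q                         ∎

module _ {c : ℕ} where

  ∑-𝟙-∉ : ∀ {js} {i : Fin c} (g : Fin c → ℕ) → i ∉ js → ∑ js (λ j → 𝟙 (i ≟ j) * g j) ≡ 0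
  ∑-𝟙-∉ {[]} g _ = refl
  ∑-𝟙-∉ {j ∷ js} {i} g i∉ with i ≟ j
  ... | yes refl = contradiction (here refl) i∉
  ... | no _     = ∑-𝟙-∉ g (i∉ ∘ there)

  ∑-𝟙≤ : ∀ {js} → Unique js → (i : Fin c) (g : Fin c → ℕ) → ∑ js (λ j → 𝟙 (i ≟ j) * g j) ≤ g i
  ∑-𝟙≤ [] i g = z≤n
  ∑-𝟙≤ {j ∷ js} js!@(_ ∷ js'!) i g with i ≟ j
  ... | no _     = ∑-𝟙≤ js'! i g
  ... | yes refl = ℕ.≤-reflexive (trans (cong₂ _+_ (ℕ.+-identityʳ (g i)) (∑-𝟙-∉ g (Unique[x∷xs]⇒x∉xs js!)))
                     (ℕ.+-identityʳ (g i)))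

  1≤∑-𝟙 : ∀ {js} {i : Fin c} → i ∈ js → 1 ≤ ∑ js (λ j → 𝟙 (i ≟ j))
  1≤∑-𝟙 {i = i} (here refl) = ℕ.≤-trans (𝟙-yes (i ≟ i) refl) (ℕ.m≤m+n _ _)
  1≤∑-𝟙 (there i∈) = ℕ.≤-trans (1≤∑-𝟙 i∈) (ℕ.m≤n+m _ _)

  -- If `h j` entries have colour `j`, the `h j` sum to at least `length xs`. Cauchy-Schwarz over
  -- the `c` colours applies, and the sum of `h j * h j` counts ordered pairs of equal colour.
  colour-energy : ∀ (xs : List A) (f : A → Fin c) →
    length xs * length xs ≤ c * ∑ xs (λ x → ∑ xs (λ y → 𝟙 (f y ≟ f x)))
  colour-energy xs f = begin
    length xs * length xs             ≤⟨ ℕ.*-mono-≤ total total ⟩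
    ∑ J h * ∑ J h                     ≤⟨ cauchy-schwarz J h ⟩
    length J * ∑ J (λ j → h j * h j)  ≡⟨ cong (_* ∑ J (λ j → h j * h j)) (length-tabulate (λ (i : Fin c) → i)) ⟩
    c * ∑ J (λ j → h j * h j)         ≤⟨ ℕ.*-monoʳ-≤ c squares ⟩
    c * ∑ xs (λ x → h (f x))          ∎
    where
    open ≤-Reasoning
    J : List (Fin c)
    J = allFin c
    h : Fin c → ℕ
    h j = ∑ xs (λ y → 𝟙 (f y ≟ j))
    total : length xs ≤ ∑ J h
    total = begin
      length xs                                 ≡⟨ ℕ.*-identityʳ (length xs) ⟨
      length xs * 1                             ≡⟨ ∑-const xs 1 ⟨
      ∑ xs (λ _ → 1)                            ≤⟨ ∑-mono xs (λ x → 1≤∑-𝟙 (∈-allFin (f x))) ⟩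
      ∑ xs (λ x → ∑ J (λ j → 𝟙 (f x ≟ j)))      ≡⟨ ∑-comm xs J _ ⟩
      ∑ J h                                     ∎
    squares : ∑ J (λ j → h j * h j) ≤ ∑ xs (λ x → h (f x))
    squares = begin
      ∑ J (λ j → h j * h j)
        ≡⟨ ∑-cong J (λ j → trans (sym (*-∑ xs (h j) _)) (∑-cong xs (λ x → ℕ.*-comm (h j) _))) ⟩
      ∑ J (λ j → ∑ xs (λ x → 𝟙 (f x ≟ j) * h j))
        ≡⟨ ∑-comm J xs _ ⟩
      ∑ xs (λ x → ∑ J (λ j → 𝟙 (f x ≟ j) * h j))
        ≤⟨ ∑-mono xs (λ x → ∑-𝟙≤ (Unique.allFin⁺ c) (f x) h) ⟩
      ∑ xs (λ x → h (f x)) ∎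

-- Subgraphs of large minimum degree

module _ {A : Set} {R : A → A → Set} (R? : ∀ x y → Dec (R x y)) (R-sym : ∀ {x y} → R x y → R y x) where

  degree-sum : List A → ℕ
  degree-sum L = ∑ L (λ x → length (filter (R? x) L))

  degree-sum-↭ : ∀ {L M} → L ↭ M → degree-sum L ≡ degree-sum M
  degree-sum-↭ {L} {M} p = trans (∑-cong L (λ x → ↭-length (filter-↭ (R? x) p))) (∑-↭ _ p)

  -- `x` contributes a row and a column of related pairs. The row has `d` entries and, by symmetry,
  -- the column at most `d`.
  degree-sum-∷ : ∀ x L → degree-sum (x ∷ L) ≤ 2 * length (filter (R? x) (x ∷ L)) + degree-sum L
  degree-sum-∷ x L = begin
    d + ∑ L (λ y → length (filter (R? y) (x ∷ L)))
      ≡⟨ cong (d +_) (∑-cong L (λ y → trans (length-filter≡∑ (R? y) (x ∷ L))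
           (cong (𝟙 (R? y x) +_) (sym (length-filter≡∑ (R? y) L))))) ⟩
    d + ∑ L (λ y → 𝟙 (R? y x) + length (filter (R? y) L))
      ≡⟨ cong (d +_) (∑-+ L _ _) ⟩
    d + (∑ L (λ y → 𝟙 (R? y x)) + degree-sum L)
      ≤⟨ ℕ.+-monoʳ-≤ d (ℕ.+-monoˡ-≤ (degree-sum L) column) ⟩
    d + (d + degree-sum L)
      ≡⟨ solve 2 (λ d e → d :+ (d :+ e) := con 2 :* d :+ e) refl d (degree-sum L) ⟩
    2 * d + degree-sum L ∎
    where
    open ≤-Reasoning
    open +-*-Solver
    d = length (filter (R? x) (x ∷ L))
    column : ∑ L (λ y → 𝟙 (R? y x)) ≤ d
    column = begin
      ∑ L (λ y → 𝟙 (R? y x))      ≤⟨ ∑-mono L (λ y → 𝟙-≤ (R? y x) (𝟙-yes (R? x y) ∘ R-sym)) ⟩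
      ∑ L (𝟙 ∘ R? x)              ≤⟨ ℕ.m≤n+m _ _ ⟩
      ∑ (x ∷ L) (𝟙 ∘ R? x)        ≡⟨ length-filter≡∑ (R? x) (x ∷ L) ⟨
      d                           ∎

  -- Delete vertices of degree below `D` while there are any. A deletion takes at most `2 * D` from
  -- the degree sum and exactly `2 * D` from the other side, so the strict inequality survives. It
  -- fails for the empty list, so the process stops earlier.
  min-degree-subgraph : ∀ D fuel {L} → length L ≤ fuel → Unique L → 2 * D * length L < degree-sum L →
    ∃[ M ] ∃[ a ] a ∈ M × Unique M × (∀ {x} → x ∈ M → D ≤ length (filter (R? x) M))
  min-degree-subgraph D fuel {[]} _ _ ()
  min-degree-subgraph D (suc fuel) {L@(a ∷ _)} l L! dense
    with any? (λ x → length (filter (R? x) L) ℕ.<? D) L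
  ... | no none = L , a , here refl , L! ,
    λ x∈L → ℕ.≮⇒≥ (All.lookup (¬Any⇒All¬ L none) x∈L)
  ... | yes some with x , x∈L , low ← find some with as , bs , eq ← ∈-∃++ x∈L =
    min-degree-subgraph D fuel {M} (s≤s⁻¹ (subst (_≤ suc fuel) (↭-length L↭) l)) M! dense′
    where
    M : List A
    M = as ++ bs
    L↭ : L ↭ x ∷ M
    L↭ = subst (_↭ x ∷ M) (sym eq) (shift x as bs)
    M! : Unique M
    M! with _ ∷ M! ← SetoidPerm.Unique-resp-↭ (setoid A) (↭⇒↭ₛ L↭) L! = M!
    open ≤-Reasoning
    dense′ : 2 * D * length M < degree-sum M
    dense′ = ℕ.+-cancelˡ-< (2 * D) _ _ (begin-strict
      2 * D + 2 * D * length M     ≡⟨ ℕ.*-suc (2 * D) (length M) ⟨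
      2 * D * suc (length M)       ≡⟨ cong (2 * D *_) (↭-length L↭) ⟨
      2 * D * length L             <⟨ dense ⟩
      degree-sum L                 ≡⟨ degree-sum-↭ L↭ ⟩
      degree-sum (x ∷ M)           ≤⟨ degree-sum-∷ x M ⟩
      2 * length (filter (R? x) (x ∷ M)) + degree-sum M
        ≡⟨ cong (λ d → 2 * d + degree-sum M) (↭-length (filter-↭ (R? x) L↭)) ⟨
      2 * length (filter (R? x) L) + degree-sum M
        ≤⟨ ℕ.+-monoˡ-≤ (degree-sum M) (ℕ.*-monoʳ-≤ 2 (ℕ.<⇒≤ low)) ⟩
      2 * D + degree-sum M         ∎)

-- Repeated colours and the colour energy graph

suc-C-2 : ∀ s → s + s C 2 ≡ suc s C 2
suc-C-2 s = trans (cong (_+ s C 2) (sym (nC1≡n s))) (nCk+nC[k+1]≡[n+1]C[k+1] s 1)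

module Repeats {n c : ℕ} (κ : Fin n → Fin n → Fin c) where

  open DecMembership (_≟_ {c}) using (_∈?_)

  colours : List (Fin n) → List (Fin c)
  colours []      = []
  colours (v ∷ S) = map (κ v) S ++ colours S

  -- The number of edges vu whose colour already occurs among the vertices after v.
  -- Two equally coloured new edges at v are not counted, so C(|S|,2) ∸ reps S only
  -- bounds the number of colours in S from above.
  reps : List (Fin n) → ℕ
  reps []      = 0
  reps (v ∷ S) = length (filter (λ u → κ v u ∈? colours S) S) + reps S

  reps-∷ : ∀ v S → reps S ≤ reps (v ∷ S)
  reps-∷ v S = ℕ.m≤n+m _ _

  -- `ts` keeps one entry for every edge that `reps` does not count; a counted edge has a colour of
  -- the later vertices, which `ts` covers already.
  colours-cover : ∀ S → ∃[ ts ] length ts + reps S ≡ length S C 2 × colours S ⊆ ts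
  colours-cover [] = [] , refl , λ ()
  colours-cover (v ∷ S) with ts , eq , cover ← colours-cover S =
    map (κ v) new ++ ts , count , cover′
    where
    seen? = λ u → κ v u ∈? colours S
    old = filter seen? S
    new = filter (¬? ∘ seen?) S
    open ≡-Reasoning
    count : length (map (κ v) new ++ ts) + (length old + reps S) ≡ suc (length S) C 2
    count = begin
      length (map (κ v) new ++ ts) + (length old + reps S)
        ≡⟨ cong (_+ (length old + reps S)) (length-++ (map (κ v) new)) ⟩
      length (map (κ v) new) + length ts + (length old + reps S)
        ≡⟨ cong (λ l → l + length ts + (length old + reps S)) (length-map (κ v) new) ⟩
      length new + length ts + (length old + reps S)
        ≡⟨ solve 4 (λ a b c d → a :+ b :+ (c :+ d) := a :+ c :+ (b :+ d)) refl
             (length new) (length ts) (length old) (reps S) ⟩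
      length new + length old + (length ts + reps S)
        ≡⟨ cong₂ _+_ (length-filter-¬ seen? S) eq ⟩
      length S + length S C 2
        ≡⟨ suc-C-2 (length S) ⟩
      suc (length S) C 2 ∎
      where open +-*-Solver
    cover′ : colours (v ∷ S) ⊆ map (κ v) new ++ ts
    cover′ j∈ with ∈-++⁻ (map (κ v) S) j∈
    ... | inj₂ j∈S = ∈-++⁺ʳ (map (κ v) new) (cover j∈S)
    ... | inj₁ j∈map with u , u∈S , refl ← ∈-map⁻ (κ v) j∈map with seen? u
    ...   | yes s = ∈-++⁺ʳ (map (κ v) new) (cover s)
    ...   | no ¬s = ∈-++⁺ˡ (∈-map⁺ (κ v) (∈-filter⁺ (¬? ∘ seen?) u∈S ¬s))

  -- The source of every gain in `reps`: each vertex of `R` is the end of an edge at `v` whose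
  -- colour is old.
  attach : ∀ {v S R} → Unique R → R ⊆ S → (∀ {u} → u ∈ R → κ v u ∈ colours S) →
    length R + reps S ≤ reps (v ∷ S)
  attach {v} {S} R! R⊆S seen = ℕ.+-monoˡ-≤ (reps S)
    (unique-⊆⇒length≤ R! λ u∈R → ∈-filter⁺ (λ u → κ v u ∈? colours S) (R⊆S u∈R) (seen u∈R))

  attach₁ : ∀ {v S u} → u ∈ S → κ v u ∈ colours S → suc (reps S) ≤ reps (v ∷ S)
  attach₁ u∈S s = attach ([] ∷ []) (λ { (here refl) → u∈S }) (λ { (here refl) → s })

  attach₂ : ∀ {v S u w} → u ≢ w → u ∈ S → w ∈ S → κ v u ∈ colours S → κ v w ∈ colours S →
    2 + reps S ≤ reps (v ∷ S)
  attach₂ u≢w u∈S w∈S s t = attach ((u≢w ∷ []) ∷ [] ∷ [])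
    (λ { (here refl) → u∈S ; (there (here refl)) → w∈S })
    (λ { (here refl) → s ; (there (here refl)) → t })

module EnergyGraph {n c : ℕ} (κ : Fin n → Fin n → Fin c)
  (κ-sym : ∀ u v → κ u v ≡ κ v u)
  (κ-loop : ∀ {u v w} → κ u u ≡ κ v w → v ≡ w) where

  open Repeats κ
  open DecMembership (_≟_ {n}) using (_∈?_)

  V² : Set
  V² = Fin n × Fin n

  -- The inequalities make both edges genuine, with different first and different second ends. They
  -- may still be one edge with its ends exchanged; stepping only to `Fresh` pairs rules that out.
  Adj : V² → V² → Set
  Adj (u₁ , u₂) (v₁ , v₂) = u₁ ≢ v₁ × u₂ ≢ v₂ × u₁ ≢ u₂ × v₁ ≢ v₂ × κ u₁ v₁ ≡ κ u₂ v₂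

  Adj? : ∀ u v → Dec (Adj u v)
  Adj? (u₁ , u₂) (v₁ , v₂) =
    ¬? (u₁ ≟ v₁) ×-dec ¬? (u₂ ≟ v₂) ×-dec ¬? (u₁ ≟ u₂) ×-dec ¬? (v₁ ≟ v₂) ×-dec
    (κ u₁ v₁ ≟ κ u₂ v₂)

  Adj-sym : ∀ {u v} → Adj u v → Adj v u
  Adj-sym {u₁ , u₂} {v₁ , v₂} (a , b , c , d , e) =
    a ∘ sym , b ∘ sym , d , c , trans (κ-sym v₁ u₁) (trans e (κ-sym u₂ v₂))

  Adj-swap : ∀ {u v} → Adj u v → Adj (swap u) (swap v)
  Adj-swap (a , b , c , d , e) = b , a , c ∘ sym , d ∘ sym , sym e

  Fresh : V² → List (Fin n) → Set
  Fresh (v₁ , v₂) S = v₁ ∉ S × v₂ ∉ S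

  Fresh? : ∀ v S → Dec (Fresh v S)
  Fresh? (v₁ , v₂) S = ¬? (v₁ ∈? S) ×-dec ¬? (v₂ ∈? S)

  Both : V² → List (Fin n) → Set
  Both (v₁ , v₂) S = v₁ ∈ S × v₂ ∈ S

  colours-∈ : ∀ {S u v} → u ∈ S → v ∈ S → u ≢ v → κ u v ∈ colours S
  colours-∈ (here refl) (here refl) u≢v = contradiction refl u≢v
  colours-∈ {w ∷ S} (here refl) (there v∈) _ = ∈-++⁺ˡ (∈-map⁺ (κ w) v∈)
  colours-∈ {w ∷ S} {u} (there u∈) (here refl) _ =
    subst (_∈ colours (w ∷ S)) (κ-sym w u) (∈-++⁺ˡ (∈-map⁺ (κ w) u∈))
  colours-∈ {w ∷ S} (there u∈) (there v∈) u≢v =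
    ∈-++⁺ʳ (map (κ w) S) (colours-∈ u∈ v∈ u≢v)

  new-colour : ∀ {S u v} → u ∈ S → κ v u ∈ colours (v ∷ S)
  new-colour {v = v} u∈S = ∈-++⁺ˡ (∈-map⁺ (κ v) u∈S)

  colour-transfer : ∀ {u v} S → Adj u v → κ (proj₁ v) (proj₁ u) ∈ colours S →
    κ (proj₂ v) (proj₂ u) ∈ colours S
  colour-transfer {u} {v} S u~v with _ , _ , _ , _ , e ← Adj-sym {u} {v} u~v =
    subst (_∈ colours S) e

  unique-pair : ∀ {v S} → proj₁ v ≢ proj₂ v → Fresh v S → Unique S →
    Unique (proj₂ v ∷ proj₁ v ∷ S)
  unique-pair v₁≢v₂ (v₁∉S , v₂∉S) S! =
    unique-∷ (λ { (here e) → v₁≢v₂ (sym e) ; (there v₂∈S) → v₂∉S v₂∈S }) (unique-∷ v₁∉S S!)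

  -- Insert the first point of `v` first: its edge to `u` brings the colour that the edge at the
  -- second point then repeats.
  attach-pair : ∀ {u v S} → Adj u v → Both u S → suc (reps S) ≤ reps (proj₂ v ∷ proj₁ v ∷ S)
  attach-pair {u} {v} {S} u~v (u₁∈S , u₂∈S) = begin
    suc (reps S)                  ≤⟨ s≤s (reps-∷ (proj₁ v) S) ⟩
    suc (reps (proj₁ v ∷ S))      ≤⟨ attach₁ (there u₂∈S)
                                       (colour-transfer {u} {v} (proj₁ v ∷ S) u~v (new-colour u₁∈S)) ⟩
    reps (proj₂ v ∷ proj₁ v ∷ S)  ∎
    where open ≤-Reasoning

  -- The same order of insertion serves `p` and `q` at once: the second point of `x` gets two edges
  -- of old colours, distinct because their other ends differ.
  attach-pair₂ : ∀ {p q x S} → proj₂ p ≢ proj₂ q → Adj p x → Adj q x → Both p S → Both q S →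
    2 + reps S ≤ reps (proj₂ x ∷ proj₁ x ∷ S)
  attach-pair₂ {p} {q} {x} {S} p₂≢q₂ p~x q~x (p₁∈S , p₂∈S) (q₁∈S , q₂∈S) = begin
    2 + reps S                    ≤⟨ s≤s (s≤s (reps-∷ (proj₁ x) S)) ⟩
    2 + reps (proj₁ x ∷ S)        ≤⟨ attach₂ p₂≢q₂ (there p₂∈S) (there q₂∈S)
                                       (colour-transfer {p} {x} (proj₁ x ∷ S) p~x (new-colour p₁∈S))
                                       (colour-transfer {q} {x} (proj₁ x ∷ S) q~x (new-colour q₁∈S)) ⟩
    reps (proj₂ x ∷ proj₁ x ∷ S)  ∎
    where open ≤-Reasoning

  -- Distinct pairs differ in some coordinate. If the second coordinates agree, the first ones
  -- differ, and the coordinates are exchanged.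
  close : ∀ {p q x S} → p ≢ q → Adj p x → Adj q x → Both p S → Both q S →
    Unique S → Fresh x S →
    ∃[ S′ ] Unique S′ × Both x S′ × length S′ ≡ 2 + length S × 2 + reps S ≤ reps S′
  close {p₁ , p₂} {q₁ , q₂} {x₁ , x₂} {S} p≢q p~x q~x p∈ q∈ S! x-fresh
    with p~x | p₂ ≟ q₂
  ... | _ , _ , _ , x₁≢x₂ , _ | no p₂≢q₂ =
    x₂ ∷ x₁ ∷ S , unique-pair x₁≢x₂ x-fresh S! , (there (here refl) , here refl) , refl ,
    attach-pair₂ p₂≢q₂ p~x q~x p∈ q∈
  ... | _ , _ , _ , x₁≢x₂ , _ | yes refl =
    x₁ ∷ x₂ ∷ S , unique-pair (x₁≢x₂ ∘ sym) (swap x-fresh) S! , (here refl , there (here refl)) , refl ,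
    attach-pair₂ {p₂ , p₁} {q₂ , q₁} {x₂ , x₁} (λ { refl → p≢q refl })
      (Adj-swap {p₁ , p₂} {x₁ , x₂} p~x) (Adj-swap {q₁ , q₂} {x₁ , x₂} q~x) (swap p∈) (swap q∈)

  -- Dense sets and the union of two walks

  Dense : ℕ → List (Fin n) → Set
  Dense s S = length S ≤ s + 2 * reps S

  -- `Dense s S` lets each repeated colour pay for two points and leaves at most `s` points unpaid,
  -- so one more repetition pays for up to two new points.
  dense-+1 : ∀ s {S S′} → length S′ ≤ 2 + length S → suc (reps S) ≤ reps S′ → Dense s S → Dense s S′
  dense-+1 s {S} {S′} l r d = begin
    length S′                 ≤⟨ l ⟩
    2 + length S              ≤⟨ s≤s (s≤s d) ⟩
    2 + (s + 2 * reps S)      ≡⟨ solve 2 (λ s r → con 2 :+ (s :+ con 2 :* r) := s :+ con 2 :* (con 1 :+ r)) refl s (reps S) ⟩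
    s + 2 * suc (reps S)      ≤⟨ ℕ.+-monoʳ-≤ s (ℕ.*-monoʳ-≤ 2 r) ⟩
    s + 2 * reps S′           ∎
    where
    open ≤-Reasoning
    open +-*-Solver

  -- `only` serves to show that a pair off both walks is off their union, `length≤` that the union
  -- is small.
  record Absorbed (s l : ℕ) (new S : List (Fin n)) : Set where
    field
      set      : List (Fin n)
      unique   : Unique set
      ⊆old     : S ⊆ set
      ⊆new     : new ⊆ set
      only     : ∀ {w} → w ∈ set → w ∈ new ⊎ w ∈ S
      length≤  : length set ≤ l + length S
      dense    : Dense s set

  -- Two new points bring one repetition. If only one point is new, the edge at the old point lies
  -- inside `S`, so the edge at the new one repeats its colour, and a single point is paid for by a
  -- whole repetition.
  absorb-pair : ∀ {s u v S} → Adj u v → Both u S → Unique S → Dense s S →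
    Absorbed s 2 (proj₁ v ∷ proj₂ v ∷ []) S
  absorb-pair {s} {u = u@(u₁ , u₂)} {v@(v₁ , v₂)} {S} u~v@(u₁≢v₁ , u₂≢v₂ , _ , v₁≢v₂ , _) (u₁∈S , u₂∈S) S! d
    with v₁ ∈? S | v₂ ∈? S
  ... | yes v₁∈S | yes v₂∈S = record
    { set = S ; unique = S! ; ⊆old = λ z → z
    ; ⊆new = λ { (here refl) → v₁∈S ; (there (here refl)) → v₂∈S }
    ; only = inj₂ ; length≤ = ℕ.m≤n+m _ 2 ; dense = d }
  ... | yes v₁∈S | no v₂∉S = record
    { set = v₂ ∷ S ; unique = unique-∷ v₂∉S S! ; ⊆old = there
    ; ⊆new = λ { (here refl) → there v₁∈S ; (there (here refl)) → here refl }
    ; only = λ { (here refl) → inj₁ (there (here refl)) ; (there w∈S) → inj₂ w∈S }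
    ; length≤ = ℕ.n≤1+n _
    ; dense = dense-+1 s {S = S} {v₂ ∷ S} (ℕ.n≤1+n _)
        (attach₁ u₂∈S (colour-transfer {u} {v} S u~v (colours-∈ v₁∈S u₁∈S (u₁≢v₁ ∘ sym)))) d }
  ... | no v₁∉S | yes v₂∈S = record
    { set = v₁ ∷ S ; unique = unique-∷ v₁∉S S! ; ⊆old = there
    ; ⊆new = λ { (here refl) → here refl ; (there (here refl)) → there v₂∈S }
    ; only = λ { (here refl) → inj₁ (here refl) ; (there w∈S) → inj₂ w∈S }
    ; length≤ = ℕ.n≤1+n _
    ; dense = dense-+1 s {S = S} {v₁ ∷ S} (ℕ.n≤1+n _)
        (attach₁ u₁∈S (colour-transfer {u₂ , u₁} {v₂ , v₁} S (Adj-swap {u} {v} u~v)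
          (colours-∈ v₂∈S u₂∈S (u₂≢v₂ ∘ sym)))) d }
  ... | no v₁∉S | no v₂∉S = record
    { set = v₂ ∷ v₁ ∷ S ; unique = unique-pair v₁≢v₂ (v₁∉S , v₂∉S) S!
    ; ⊆old = there ∘ there
    ; ⊆new = λ { (here refl) → there (here refl) ; (there (here refl)) → here refl }
    ; only = λ { (here refl) → inj₁ (there (here refl)) ; (there (here refl)) → inj₁ (here refl)
               ; (there (there w∈S)) → inj₂ w∈S }
    ; length≤ = ℕ.≤-refl
    ; dense = dense-+1 s {S = S} {v₂ ∷ v₁ ∷ S} ℕ.≤-refl (attach-pair {u} {v} u~v (u₁∈S , u₂∈S)) d }

  -- The list collects all points visited, so `Fresh` in a step excludes every earlier point of the
  -- walk.
  data Path (a : V²) : ℕ → V² → List (Fin n) → Set where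
    start : Path a 0 a (proj₁ a ∷ proj₂ a ∷ [])
    step  : ∀ {t u v S} → Path a t u S → Adj u v → Fresh v S →
            Path a (suc t) v (proj₁ v ∷ proj₂ v ∷ S)

  path-length : ∀ {a t u S} → Path a t u S → length S ≡ 2 + 2 * t
  path-length start = refl
  path-length {t = suc t} (step P _ _) =
    trans (cong (2 +_) (path-length P)) (cong (2 +_) (sym (ℕ.*-suc 2 t)))

  path-head : ∀ {a t u S} → Path a t u S → Both u S
  path-head start        = here refl , there (here refl)
  path-head (step _ _ _) = here refl , there (here refl)

  -- Pairs are absorbed in the order of the walk; each is adjacent to its predecessor, which is in
  -- the set by then.
  absorb-path : ∀ {s a t u Q S} → Path a t u Q → Both a S → Unique S → Dense s S →
    Absorbed s (2 * t) Q S
  absorb-path {S = S} start (a₁∈S , a₂∈S) S! d = record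
    { set = S ; unique = S! ; ⊆old = λ z → z
    ; ⊆new = λ { (here refl) → a₁∈S ; (there (here refl)) → a₂∈S }
    ; only = inj₂ ; length≤ = ℕ.≤-refl ; dense = d }
  absorb-path {s} {a} {suc t} {v} {_} {S} (step {u = u} {S = Q} P u~v _) a∈ S! d = record
    { set = A₂.set ; unique = A₂.unique ; ⊆old = A₂.⊆old ∘ A₁.⊆old
    ; ⊆new = λ { (here refl) → A₂.⊆new (here refl) ; (there (here refl)) → A₂.⊆new (there (here refl))
               ; (there (there w∈Q)) → A₂.⊆old (A₁.⊆new w∈Q) }
    ; only = λ w∈ → case-only (A₂.only w∈)
    ; length≤ = length≤ ; dense = A₂.dense }
    where
    module A₁ = Absorbed (absorb-path {s} P a∈ S! d)
    u∈ : Both u A₁.set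
    u∈ = A₁.⊆new (proj₁ (path-head P)) , A₁.⊆new (proj₂ (path-head P))
    module A₂ = Absorbed (absorb-pair {s} {u} {v} u~v u∈ A₁.unique A₁.dense)
    case-only : ∀ {w} → w ∈ proj₁ v ∷ proj₂ v ∷ [] ⊎ w ∈ A₁.set → w ∈ proj₁ v ∷ proj₂ v ∷ Q ⊎ w ∈ S
    case-only (inj₁ (here e)) = inj₁ (here e)
    case-only (inj₁ (there (here e))) = inj₁ (there (here e))
    case-only (inj₂ w∈) with A₁.only w∈
    ... | inj₁ w∈Q = inj₁ (there (there w∈Q))
    ... | inj₂ w∈S = inj₂ w∈S
    open ≤-Reasoning
    length≤ : length A₂.set ≤ 2 * suc t + length S
    length≤ = begin
      length A₂.set             ≤⟨ A₂.length≤ ⟩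
      2 + length A₁.set         ≤⟨ ℕ.+-monoʳ-≤ 2 A₁.length≤ ⟩
      2 + (2 * t + length S)    ≡⟨ cong (_+ length S) (ℕ.*-suc 2 t) ⟨
      2 * suc t + length S      ∎

  -- Two points in S contribute no repeated colour, each further pair on either path
  -- is paid for by one, and the second edge into x gives the missing one.
  collision : ∀ {a t p q x P Q} → proj₁ a ≢ proj₂ a → p ≢ q → Path a t p P → Path a t q Q →
    Adj p x → Adj q x → Fresh x P → Fresh x Q →
    ∃[ S ] Unique S × Both x S × length S ≤ 4 * suc t × Dense 0 S
  collision {a} {t} {p} {q} {x} {P} {Q} a₁≢a₂ p≢q path-p path-q p~x q~x (x₁∉P , x₂∉P) (x₁∉Q , x₂∉Q) =
    let S′ , S′! , x∈ , l , r = close {p} {q} {x} p≢q p~x q~x p∈ q∈ A₂.unique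
                                  (fresh x₁∉P x₁∉Q , fresh x₂∉P x₂∉Q)
    in S′ , S′! , x∈ , size {S′} l , dens {S′} l r
    where
    a-set : List (Fin n)
    a-set = proj₁ a ∷ proj₂ a ∷ []
    module A₁ = Absorbed (absorb-path {2} {S = a-set} path-p (here refl , there (here refl))
                            ((a₁≢a₂ ∷ []) ∷ [] ∷ []) (s≤s (s≤s z≤n)))
    module A₂ = Absorbed (absorb-path {2} path-q (A₁.⊆old (here refl) , A₁.⊆old (there (here refl)))
                            A₁.unique A₁.dense)
    p∈ : Both p A₂.set
    p∈ = A₂.⊆old (A₁.⊆new (proj₁ (path-head path-p))) , A₂.⊆old (A₁.⊆new (proj₂ (path-head path-p)))
    q∈ : Both q A₂.set
    q∈ = A₂.⊆new (proj₁ (path-head path-q)) , A₂.⊆new (proj₂ (path-head path-q))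
    a∈P : ∀ {t u P} → Path a t u P → a-set ⊆ P
    a∈P start = λ z → z
    a∈P (step P _ _) = there ∘ there ∘ a∈P P
    fresh : ∀ {w} → w ∉ P → w ∉ Q → w ∉ A₂.set
    fresh w∉P w∉Q w∈ with A₂.only w∈
    ... | inj₁ w∈Q = w∉Q w∈Q
    ... | inj₂ w∈₁ with A₁.only w∈₁
    ...   | inj₁ w∈P = w∉P w∈P
    ...   | inj₂ w∈a = w∉P (a∈P path-p w∈a)
    open ≤-Reasoning
    open +-*-Solver
    size : ∀ {S′ : List (Fin n)} → length S′ ≡ 2 + length A₂.set → length S′ ≤ 4 * suc t
    size {S′} l = begin
      length S′                       ≡⟨ l ⟩
      2 + length A₂.set               ≤⟨ ℕ.+-monoʳ-≤ 2 A₂.length≤ ⟩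
      2 + (2 * t + length A₁.set)     ≤⟨ ℕ.+-monoʳ-≤ 2 (ℕ.+-monoʳ-≤ (2 * t) A₁.length≤) ⟩
      2 + (2 * t + (2 * t + 2))       ≡⟨ solve 1 (λ t → con 2 :+ (con 2 :* t :+ (con 2 :* t :+ con 2)) := con 4 :* (con 1 :+ t)) refl t ⟩
      4 * suc t                       ∎
    dens : ∀ {S′} → length S′ ≡ 2 + length A₂.set → 2 + reps A₂.set ≤ reps S′ → Dense 0 S′
    dens {S′} l r = begin
      length S′                       ≡⟨ l ⟩
      2 + length A₂.set               ≤⟨ ℕ.+-monoʳ-≤ 2 A₂.dense ⟩
      2 + (2 + 2 * reps A₂.set)       ≡⟨ solve 1 (λ r → con 2 :+ (con 2 :+ con 2 :* r) := con 2 :* (con 2 :+ r)) refl (reps A₂.set) ⟩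
      2 * (2 + reps A₂.set)           ≤⟨ ℕ.*-monoʳ-≤ 2 r ⟩
      2 * reps S′                     ∎

  -- Monochromatic stars and blocked neighbours

  module FewRepeats (m : ℕ) (0<m : 0 < m)
    (few : ∀ {S} → Unique S → length S ≤ 4 * m → reps S < 2 * m) where

    open +-*-Solver

    -- `u` stands last, so every vertex of `R` but the final one has an edge to `u` whose colour `j`
    -- already occurs at the next vertex.
    star-reps : ∀ {u j} R → (∀ {v} → v ∈ R → κ u v ≡ j) → length R ≤ suc (reps (R ++ u ∷ []))
    star-reps [] _ = z≤n
    star-reps (v ∷ []) _ = s≤s z≤n
    star-reps {u} (v ∷ w ∷ R) mono =
      s≤s (ℕ.≤-trans (star-reps (w ∷ R) (mono ∘ there)) (attach₁ {v} (there u∈) seen))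
      where
      u∈ : u ∈ R ++ u ∷ []
      u∈ = ∈-++⁺ʳ R (here refl)
      seen : κ v u ∈ colours (w ∷ R ++ u ∷ [])
      seen = subst (_∈ colours (w ∷ R ++ u ∷ []))
        (trans (κ-sym w u) (trans (mono (there (here refl))) (sym (trans (κ-sym v u) (mono (here refl))))))
        (new-colour u∈)

    -- `2 * m + 1` edges of one colour at `u` span `2 * m + 2` points with at least `2 * m`
    -- repetitions, and `0 < m` makes `2 * m + 2` at most `4 * m`.
    star : ∀ u j {M} → Unique M → (∀ {v} → v ∈ M → κ u v ≡ j) → length M ≤ 2 * m
    star u j {M} M! mono with u ∈? M
    -- Here `j` is the colour of the loop at `u`, and `κ-loop` leaves `u` as the only member of `M`.
    ... | yes u∈M = ℕ.≤-trans
      (unique-⊆⇒length≤ {ys = u ∷ []} M! λ v∈M →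
        here (sym (κ-loop (trans (mono u∈M) (sym (mono v∈M))))))
      (ℕ.≤-trans 0<m (ℕ.m≤m+n m _))
    ... | no u∉M = ℕ.≮⇒≥ λ 2m<M →
      let R = take (suc (2 * m)) M
          R⊆M : R ⊆ M
          R⊆M = take-⊆ (suc (2 * m)) M
          len : length R ≡ suc (2 * m)
          len = trans (length-take (suc (2 * m)) M) (ℕ.m≤n⇒m⊓n≡m 2m<M)
          S! : Unique (R ++ u ∷ [])
          S! = Unique.++⁺ (Unique.take⁺ (suc (2 * m)) M!) ([] ∷ [])
                 λ { (v∈R , here refl) → u∉M (R⊆M v∈R) }
          size : length (R ++ u ∷ []) ≤ 4 * m
          size = begin
            length (R ++ u ∷ [])   ≡⟨ length-++ R ⟩
            length R + 1           ≡⟨ cong (_+ 1) len ⟩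
            suc (2 * m) + 1        ≤⟨ ℕ.+-monoʳ-≤ (suc (2 * m)) 0<m ⟩
            suc (2 * m) + m        ≤⟨ s≤s (ℕ.+-monoʳ-≤ (2 * m) (ℕ.m≤m+n m _)) ⟩
            suc (2 * m) + (m + (m ∸ 1)) ≡⟨ solve 3 (λ a m p → (con 1 :+ a) :+ (m :+ p) := a :+ m :+ (con 1 :+ p)) refl (2 * m) m (m ∸ 1) ⟩
            2 * m + m + suc (m ∸ 1) ≡⟨ cong (2 * m + m +_) (ℕ.m+[n∸m]≡n 0<m) ⟩
            2 * m + m + m           ≡⟨ solve 1 (λ m → con 2 :* m :+ m :+ m := con 4 :* m) refl m ⟩
            4 * m                  ∎
      in ℕ.<⇒≱ (few S! size) (s≤s⁻¹ (subst (_≤ suc (reps (R ++ u ∷ []))) len (star-reps R (mono ∘ R⊆M))))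
      where
      open ≤-Reasoning
      take-⊆ : ∀ k (xs : List (Fin n)) → take k xs ⊆ xs
      take-⊆ (suc k) (x ∷ xs) (here e) = here e
      take-⊆ (suc k) (x ∷ xs) (there y∈) = there (take-⊆ k xs y∈)

    -- The pairs in `M` are parametrised by vertices `w` that form a monochromatic star at `t`. In
    -- the uses, `f` fixes one coordinate of the pair.
    slice : ∀ (f : Fin n → V²) t j {M} → Unique M →
      (∀ {v} → v ∈ M → ∃[ w ] v ≡ f w × κ t w ≡ j) → length M ≤ 2 * m
    slice f t j {M} M! within = begin
      length M                 ≤⟨ unique-⊆⇒length≤ M! sub ⟩
      length (map f ws)        ≡⟨ length-map f ws ⟩
      length ws                ≤⟨ star t j (Unique.filter⁺ mono? (Unique.allFin⁺ n))
                                    (proj₂ ∘ ∈-filter⁻ mono? {xs = allFin n}) ⟩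
      2 * m                    ∎
      where
      open ≤-Reasoning
      mono? = λ w → κ t w ≟ j
      ws = filter mono? (allFin n)
      sub : M ⊆ map f ws
      sub v∈M with w , refl , e ← within v∈M = ∈-map⁺ f (∈-filter⁺ mono? (∈-allFin w) e)

    -- A point `s` blocks at most `4 * m` neighbours of `u`: if the first coordinate of a neighbour
    -- is `s`, its second is joined to `u₂` in the colour of `u₁` and `s`, which leaves `2 * m`
    -- choices; likewise with coordinates exchanged.
    fresh-bound : ∀ u {M} S → Unique M → (∀ {v} → v ∈ M → Adj u v) →
      length M ≤ length (filter (λ v → Fresh? v S) M) + length S * (4 * m)
    fresh-bound u {M} [] M! adj = ℕ.≤-trans
      (unique-⊆⇒length≤ M! λ v∈M → ∈-filter⁺ (λ v → Fresh? v []) v∈M ((λ ()) , λ ()))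
      (ℕ.m≤m+n _ 0)
    fresh-bound u@(u₁ , u₂) {M} (s ∷ S) M! adj = begin
      length M
        ≤⟨ fresh-bound u S M! adj ⟩
      length (filter (fresh? S) M) + length S * (4 * m)
        ≤⟨ ℕ.+-monoˡ-≤ (length S * (4 * m)) (unique-⊆⇒length≤ (Unique.filter⁺ (fresh? S) M!) sub) ⟩
      length (F ++ G₁ ++ G₂) + length S * (4 * m)
        ≡⟨ cong (_+ length S * (4 * m)) (trans (length-++ F) (cong (length F +_) (length-++ G₁))) ⟩
      length F + (length G₁ + length G₂) + length S * (4 * m)
        ≤⟨ ℕ.+-monoˡ-≤ _ (ℕ.+-monoʳ-≤ (length F) (ℕ.+-mono-≤ G₁-bound G₂-bound)) ⟩
      length F + (2 * m + 2 * m) + length S * (4 * m)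
        ≡⟨ solve 3 (λ f m l → f :+ (con 2 :* m :+ con 2 :* m) :+ l :* (con 4 :* m) := f :+ (con 1 :+ l) :* (con 4 :* m))
             refl (length F) m (length S) ⟩
      length F + suc (length S) * (4 * m) ∎
      where
      open ≤-Reasoning
      fresh? = λ S v → Fresh? v S
      at₁? = λ (v : V²) → proj₁ v ≟ s
      at₂? = λ (v : V²) → proj₂ v ≟ s
      F  = filter (fresh? (s ∷ S)) M
      G₁ = filter at₁? M
      G₂ = filter at₂? M
      within₁ : ∀ {v} → v ∈ G₁ → ∃[ w ] v ≡ (s , w) × κ u₂ w ≡ κ u₁ s
      within₁ v∈ with v∈M , refl ← ∈-filter⁻ at₁? {xs = M} v∈
        with _ , _ , _ , _ , e ← adj v∈M = _ , refl , sym e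
      within₂ : ∀ {v} → v ∈ G₂ → ∃[ w ] v ≡ (w , s) × κ u₁ w ≡ κ u₂ s
      within₂ v∈ with v∈M , refl ← ∈-filter⁻ at₂? {xs = M} v∈
        with _ , _ , _ , _ , e ← adj v∈M = _ , refl , e
      G₁-bound : length G₁ ≤ 2 * m
      G₁-bound = slice (s ,_) u₂ (κ u₁ s) (Unique.filter⁺ at₁? M!) within₁
      G₂-bound : length G₂ ≤ 2 * m
      G₂-bound = slice (_, s) u₁ (κ u₂ s) (Unique.filter⁺ at₂? M!) within₂
      sub : filter (fresh? S) M ⊆ F ++ G₁ ++ G₂
      sub {v₁ , v₂} v∈ with v∈M , v₁∉S , v₂∉S ← ∈-filter⁻ (fresh? S) {xs = M} v∈
        with v₁ ≟ s | v₂ ≟ s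
      ... | yes refl | _ = ∈-++⁺ʳ F (∈-++⁺ˡ (∈-filter⁺ at₁? v∈M refl))
      ... | no _ | yes refl = ∈-++⁺ʳ F (∈-++⁺ʳ G₁ (∈-filter⁺ at₂? v∈M refl))
      ... | no v₁≢s | no v₂≢s = ∈-++⁺ˡ (∈-filter⁺ (fresh? (s ∷ S)) v∈M
        ( (λ { (here e) → v₁≢s e ; (there v₁∈S) → v₁∉S v₁∈S })
        , (λ { (here e) → v₂≢s e ; (there v₂∈S) → v₂∉S v₂∈S })))

    -- Branching walks in a subgraph of large minimum degree

    module MinDegree (L : List V²) (L! : Unique L) (b : ℕ)
      (degree : ∀ {u} → u ∈ L → suc b + (4 * m) * (4 * m) ≤ length (filter (Adj? u) L)) where

      fresh-neighbours : V² → List (Fin n) → List V²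
      fresh-neighbours u S = filter (λ v → Fresh? v S) (filter (Adj? u) L)

      fresh-neighbours-unique : ∀ u S → Unique (fresh-neighbours u S)
      fresh-neighbours-unique u S = Unique.filter⁺ (λ v → Fresh? v S) (Unique.filter⁺ (Adj? u) L!)

      fresh-neighbours⁻ : ∀ {u S v} → v ∈ fresh-neighbours u S → v ∈ L × Adj u v × Fresh v S
      fresh-neighbours⁻ {u} {S} v∈
        with v∈N , fresh ← ∈-filter⁻ (λ v → Fresh? v S) {xs = filter (Adj? u) L} v∈
        with v∈L , u~v ← ∈-filter⁻ (Adj? u) {xs = L} v∈N = v∈L , u~v , fresh

      -- The surplus `(4 * m) * (4 * m)` in the degree pays for at most `4 * m` points blocking at
      -- most `4 * m` neighbours each.
      many-fresh : ∀ {u S} → u ∈ L → length S ≤ 4 * m → suc b ≤ length (fresh-neighbours u S)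
      many-fresh {u} {S} u∈L l = ℕ.+-cancelʳ-≤ ((4 * m) * (4 * m)) _ _ (begin
        suc b + (4 * m) * (4 * m)                              ≤⟨ degree u∈L ⟩
        length (filter (Adj? u) L)                             ≤⟨ fresh-bound u S (Unique.filter⁺ (Adj? u) L!)
                                                                    (λ {v} → proj₂ ∘ ∈-filter⁻ (Adj? u) {v} {L}) ⟩
        length (fresh-neighbours u S) + length S * (4 * m)     ≤⟨ ℕ.+-monoʳ-≤ (length (fresh-neighbours u S)) (ℕ.*-monoˡ-≤ (4 * m) l) ⟩
        length (fresh-neighbours u S) + (4 * m) * (4 * m)      ∎)
        where open ≤-Reasoning

      -- A dense set can always be enlarged by a fresh neighbour until it has 4m points.
      no-dense : ∀ fuel {S x} → 4 * m ≤ fuel + length S → Unique S → x ∈ L → Both x S →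
        length S ≤ 4 * m → ¬ Dense 0 S
      no-dense fuel {S} {x} enough S! x∈L x∈S l d = grow fuel enough
        where
        -- Density and `reps S < 2 * m` give at most `4 * m - 2` points, so a whole pair still fits;
        -- reaching `4 * m` points is the contradiction sought.
        room : 2 + length S ≤ 4 * m
        room = begin
          2 + length S         ≤⟨ ℕ.+-monoʳ-≤ 2 d ⟩
          2 + 2 * reps S       ≡⟨ ℕ.*-suc 2 (reps S) ⟨
          2 * suc (reps S)     ≤⟨ ℕ.*-monoʳ-≤ 2 (few S! l) ⟩
          2 * (2 * m)          ≡⟨ ℕ.*-assoc 2 2 m ⟨
          4 * m                ∎
          where open ≤-Reasoning
        grow : ∀ fuel → ¬ 4 * m ≤ fuel + length S
        grow zero enough = ℕ.<⇒≱ (ℕ.≤-trans (ℕ.n≤1+n _) room) enough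
        grow (suc fuel) enough
          with fresh-neighbours x S in eq | many-fresh {x} {S} x∈L l
        ... | v ∷ _ | _
          with v∈L , x~v@(_ , _ , _ , v₁≢v₂ , _) , fresh ←
                 fresh-neighbours⁻ {x} {S} (subst (v ∈_) (sym eq) (here refl))
          = no-dense fuel
              (ℕ.≤-trans enough (ℕ.≤-trans (ℕ.≤-reflexive (sym (ℕ.+-suc fuel _))) (ℕ.+-monoʳ-≤ fuel (ℕ.n≤1+n _))))
              (unique-pair v₁≢v₂ fresh S!) v∈L (there (here refl) , here refl) room
              (dense-+1 0 {S} {proj₂ v ∷ proj₁ v ∷ S} ℕ.≤-refl (attach-pair {x} {v} x~v x∈S) d)

      module Walks (a : V²) (a∈L : a ∈ L) where

        record Walk (t : ℕ) : Set where
          field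
            head   : V²
            points : List (Fin n)
            head∈L : head ∈ L
            path   : Path a t head points
        open Walk

        successors : ∀ {t} → Walk t → List V²
        successors W = fresh-neighbours (head W) (points W)

        points≤ : ∀ {t} (W : Walk t) → t < m → length (points W) ≤ 4 * m
        points≤ {t} W t<m = begin
          length (points W)   ≡⟨ path-length (path W) ⟩
          2 + 2 * t           ≡⟨ ℕ.*-suc 2 t ⟨
          2 * suc t           ≤⟨ ℕ.*-mono-≤ {2} {4} (s≤s (s≤s z≤n)) t<m ⟩
          4 * m               ∎
          where open ≤-Reasoning

        -- Only the first `suc b` fresh neighbours are offered, so all walks branch equally.
        pick : ∀ {t} (W : Walk t) → t < m → Fin (suc b) → Fin (length (successors W))
        pick W t<m w = inject≤ w (many-fresh (head∈L W) (points≤ W t<m))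

        abstract
          next : ∀ {t} → Walk t → t < m → Fin (suc b) → Walk (suc t)
          next W t<m w with v∈L , adj , fresh ← fresh-neighbours⁻ {head W} {points W} (∈-lookup {xs = successors W} (pick W t<m w))
            = record { head∈L = v∈L ; path = step (path W) adj fresh }

          next-injective : ∀ {t} (W : Walk t) (t<m : t < m) {w w′} →
            head (next W t<m w) ≡ head (next W t<m w′) → w ≡ w′
          next-injective W t<m e = inject≤-injective _ _ _ _
            (lookup-injective (fresh-neighbours-unique (head W) (points W)) _ _ e)

          next-step : ∀ {t} (W : Walk t) (t<m : t < m) w →
            Adj (head W) (head (next W t<m w)) × Fresh (head (next W t<m w)) (points W)
          next-step W t<m w =
            proj₂ (fresh-neighbours⁻ {head W} {points W} (∈-lookup {xs = successors W} (pick W t<m w)))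

        -- The digits of the index in base `suc b` steer the walk: the leading digit chooses the
        -- last step, the others the walk before it.
        walk : ∀ t → t ≤ m → Fin (suc b ^ t) → Walk t
        walk zero _ _ = record { head∈L = a∈L ; path = start }
        walk (suc t) t<m i =
          next (walk t (ℕ.<⇒≤ t<m) (proj₂ (remQuot {suc b} (suc b ^ t) i))) t<m
               (proj₁ (remQuot {suc b} (suc b ^ t) i))

        a₁≢a₂ : proj₁ a ≢ proj₂ a
        a₁≢a₂ with fresh-neighbours a [] in eq | many-fresh {a} {[]} a∈L z≤n
        ... | v ∷ _ | _
          with _ , (_ , _ , a₁≢a₂ , _) , _ ← fresh-neighbours⁻ {a} {[]} (subst (v ∈_) (sym eq) (here refl))
          = a₁≢a₂

        -- Different predecessors would give the dense set of `collision` on at most `4 * suc t`,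
        -- hence at most `4 * m`, points, against `no-dense`.
        predecessors-agree : ∀ {t x} (W W′ : Walk t) → t < m → x ∈ L →
          Adj (head W) x × Fresh x (points W) → Adj (head W′) x × Fresh x (points W′) →
          head W ≡ head W′
        predecessors-agree {t} {x} W W′ t<m x∈L (p~x , x∉P) (q~x , x∉Q) =
          decidable-stable (≡-dec _≟_ _≟_ (head W) (head W′)) λ p≢q →
            let S , S! , x∈S , size , dense =
                  collision {p = head W} {head W′} {x} a₁≢a₂ p≢q (path W) (path W′) p~x q~x x∉P x∉Q
            in no-dense (4 * m) {S} {x} (ℕ.m≤m+n _ _) S! x∈L x∈S
                 (ℕ.≤-trans size (ℕ.*-monoʳ-≤ 4 t<m)) dense

        heads-agree : ∀ {t} (W W′ : Walk t) (t<m : t < m) w w′ →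
          head (next W t<m w) ≡ head (next W′ t<m w′) → head W ≡ head W′
        heads-agree {t} W W′ t<m w w′ e =
          predecessors-agree {x = head (next W t<m w)} W W′ t<m (head∈L (next W t<m w)) (next-step W t<m w)
            (subst (λ x → Adj (head W′) x × Fresh x (points W′)) (sym e) (next-step W′ t<m w′))

        -- Equal final heads force equal heads one step earlier, so by induction the earlier digits
        -- agree. Both last steps then leave the same walk, and the head reached determines the
        -- choice made there.
        walk-injective : ∀ t (t≤m : t ≤ m) i j → head (walk t t≤m i) ≡ head (walk t t≤m j) → i ≡ j
        walk-injective zero t≤m zero zero _ = refl
        walk-injective (suc t) t<m i j e = begin
          i                             ≡⟨ combine-remQuot {suc b} (suc b ^ t) i ⟨
          uncurry combine (digits i)    ≡⟨ cong₂ combine first rest ⟩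
          uncurry combine (digits j)    ≡⟨ combine-remQuot {suc b} (suc b ^ t) j ⟩
          j                             ∎
          where
          open ≡-Reasoning
          digits : Fin (suc b ^ suc t) → Fin (suc b) × Fin (suc b ^ t)
          digits = remQuot {suc b} (suc b ^ t)
          init : Fin (suc b ^ t) → Walk t
          init = walk t (ℕ.<⇒≤ t<m)
          rest : proj₂ (digits i) ≡ proj₂ (digits j)
          rest = walk-injective t (ℕ.<⇒≤ t<m) (proj₂ (digits i)) (proj₂ (digits j))
            (heads-agree (init (proj₂ (digits i))) (init (proj₂ (digits j))) t<m (proj₁ (digits i)) (proj₁ (digits j)) e)
          first : proj₁ (digits i) ≡ proj₁ (digits j)
          first = next-injective (init (proj₂ (digits i))) t<m
            (trans e (cong (λ r → head (next (init r) t<m (proj₁ (digits j)))) (sym rest)))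

        few-walks : suc b ^ m ≤ n * n
        few-walks = injective⇒≤ {f = code ∘ head ∘ walk m ℕ.≤-refl}
          (walk-injective m ℕ.≤-refl _ _ ∘ code-injective)
          where
          code : V² → Fin (n * n)
          code (u₁ , u₂) = combine u₁ u₂
          code-injective : ∀ {u v} → code u ≡ code v → u ≡ v
          code-injective {u₁ , u₂} {v₁ , v₂} e with refl , refl ← combine-injective u₁ u₂ v₁ v₂ e = refl

    -- Pairs of equal colour and the energy

    V²-list : List V²
    V²-list = cartesianProduct (allFin n) (allFin n)

    V²-unique : Unique V²-list
    V²-unique = Unique.cartesianProduct⁺ (Unique.allFin⁺ n) (Unique.allFin⁺ n)

    length-V² : length V²-list ≡ n * n
    length-V² = trans (length-cartesianProduct (allFin n) (allFin n))
      (cong₂ _*_ (length-tabulate {n = n} (λ i → i)) (length-tabulate {n = n} (λ i → i)))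

    -- Exchanging the two middle sums regroups two edges into two vertices of the energy graph.
    ∑-transpose : ∀ (g : V² → V² → ℕ) →
      ∑ V²-list (λ e → ∑ V²-list (λ f → g (proj₁ e , proj₁ f) (proj₂ e , proj₂ f))) ≡
      ∑ V²-list (λ u → ∑ V²-list (g u))
    ∑-transpose g = begin
      ∑ V²-list (λ e → ∑ V²-list (λ f → g (proj₁ e , proj₁ f) (proj₂ e , proj₂ f)))
        ≡⟨ ∑-cartesianProduct V V _ ⟩
      ∑ V (λ u₁ → ∑ V (λ v₁ → ∑ V²-list (λ f → g (u₁ , proj₁ f) (v₁ , proj₂ f))))
        ≡⟨ ∑-cong V (λ u₁ → ∑-cong V (λ v₁ → ∑-cartesianProduct V V _)) ⟩
      ∑ V (λ u₁ → ∑ V (λ v₁ → ∑ V (λ u₂ → ∑ V (λ v₂ → g (u₁ , u₂) (v₁ , v₂)))))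
        ≡⟨ ∑-cong V (λ u₁ → ∑-comm V V _) ⟩
      ∑ V (λ u₁ → ∑ V (λ u₂ → ∑ V (λ v₁ → ∑ V (λ v₂ → g (u₁ , u₂) (v₁ , v₂)))))
        ≡⟨ ∑-cong V (λ u₁ → ∑-cong V (λ u₂ → ∑-cartesianProduct V V _)) ⟨
      ∑ V (λ u₁ → ∑ V (λ u₂ → ∑ V²-list (g (u₁ , u₂))))
        ≡⟨ ∑-cartesianProduct V V _ ⟨
      ∑ V²-list (λ u → ∑ V²-list (g u)) ∎
      where
      open ≡-Reasoning
      V : List (Fin n)
      V = allFin n

    edge-colour : V² → Fin c
    edge-colour = uncurry κ

    colour-pairs : ℕ
    colour-pairs = ∑ V²-list (λ e → ∑ V²-list (λ f → 𝟙 (edge-colour f ≟ edge-colour e)))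

    energy : ℕ
    energy = degree-sum Adj? (λ {u} {v} → Adj-sym {u} {v}) V²-list

    -- The three ways in which pairs of equal colour fail to give adjacent vertices. The first two
    -- relate edges; `LoopLeft` relates vertices of the energy graph and makes `u₁`, `v₁` a loop.
    SameTail SameHead LoopLeft : V² → V² → Set
    SameTail (u₁ , v₁) (u₂ , v₂) = u₂ ≡ u₁ × κ u₁ v₂ ≡ κ u₁ v₁
    SameHead (u₁ , v₁) (u₂ , v₂) = v₂ ≡ v₁ × κ v₁ u₂ ≡ κ v₁ u₁
    LoopLeft (u₁ , u₂) (v₁ , v₂) = v₁ ≡ u₁ × κ u₂ v₂ ≡ κ u₁ u₁

    SameTail? : ∀ e f → Dec (SameTail e f)
    SameTail? (u₁ , v₁) (u₂ , v₂) = (u₂ ≟ u₁) ×-dec (κ u₁ v₂ ≟ κ u₁ v₁)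

    SameHead? : ∀ e f → Dec (SameHead e f)
    SameHead? (u₁ , v₁) (u₂ , v₂) = (v₂ ≟ v₁) ×-dec (κ v₁ u₂ ≟ κ v₁ u₁)

    LoopLeft? : ∀ u v → Dec (LoopLeft u v)
    LoopLeft? (u₁ , u₂) (v₁ , v₂) = (v₁ ≟ u₁) ×-dec (κ u₂ v₂ ≟ κ u₁ u₁)

    slices : ∀ {R : V² → V² → Set} (R? : ∀ x y → Dec (R x y)) →
      (∀ x → ∃[ f ] ∃[ t ] ∃[ j ] ∀ {y} → R x y → ∃[ w ] y ≡ f w × κ t w ≡ j) →
      ∑ V²-list (λ x → ∑ V²-list (𝟙 ∘ R? x)) ≤ n * n * (2 * m)
    slices R? within = begin
      ∑ V²-list (λ x → ∑ V²-list (𝟙 ∘ R? x))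
        ≡⟨ ∑-cong V²-list (λ x → length-filter≡∑ (R? x) V²-list) ⟨
      ∑ V²-list (λ x → length (filter (R? x) V²-list))
        ≤⟨ ∑-mono V²-list bound ⟩
      ∑ V²-list (λ _ → 2 * m)
        ≡⟨ ∑-const V²-list (2 * m) ⟩
      length V²-list * (2 * m)
        ≡⟨ cong (_* (2 * m)) length-V² ⟩
      n * n * (2 * m) ∎
      where
      open ≤-Reasoning
      bound : ∀ x → length (filter (R? x) V²-list) ≤ 2 * m
      bound x with f , t , j , sl ← within x =
        slice f t j (Unique.filter⁺ (R? x) V²-unique) (λ y∈ → sl (proj₂ (∈-filter⁻ (R? x) {xs = V²-list} y∈)))

    -- If `u₂`, `v₂` form a loop, `κ-loop` makes `u₁`, `v₁` a loop too, so no fourth exception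
    -- arises.
    equal-colours : ∀ u₁ v₁ u₂ v₂ → κ u₂ v₂ ≡ κ u₁ v₁ →
      Adj (u₁ , u₂) (v₁ , v₂) ⊎ SameTail (u₁ , v₁) (u₂ , v₂) ⊎
      SameHead (u₁ , v₁) (u₂ , v₂) ⊎ LoopLeft (u₁ , u₂) (v₁ , v₂)
    equal-colours u₁ v₁ u₂ v₂ e with u₂ ≟ u₁ | v₂ ≟ v₁ | v₁ ≟ u₁
    ... | yes refl | _ | _ = inj₂ (inj₁ (refl , e))
    ... | no _ | yes refl | _ = inj₂ (inj₂ (inj₁ (refl , trans (κ-sym v₁ u₂) (trans e (κ-sym u₁ v₁)))))
    ... | no _ | no _ | yes refl = inj₂ (inj₂ (inj₂ (refl , e)))
    ... | no u₂≢u₁ | no v₂≢v₁ | no v₁≢u₁ =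
      inj₁ (v₁≢u₁ ∘ sym , (λ { refl → v₁≢u₁ (sym (κ-loop e)) }) , u₂≢u₁ ∘ sym , v₂≢v₁ ∘ sym , sym e)

    colour-pairs≤ : colour-pairs ≤ energy + 3 * (n * n * (2 * m))
    colour-pairs≤ = begin
      colour-pairs
        ≤⟨ ∑-mono P (λ e → ∑-mono P (λ f → pointwise e f)) ⟩
      ∑ P (λ e → ∑ P (λ f → adj e f + (tail e f + (head e f + loop e f))))
        ≡⟨ ∑∑-+ adj _ ⟩
      ∑∑ adj + ∑∑ (λ e f → tail e f + (head e f + loop e f))
        ≡⟨ cong (∑∑ adj +_) (trans (∑∑-+ tail _) (cong (∑∑ tail +_) (∑∑-+ head loop))) ⟩
      ∑∑ adj + (∑∑ tail + (∑∑ head + ∑∑ loop))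
        -- `Adj` and `LoopLeft` live on vertices of the energy graph, so their sums are regrouped.
        ≡⟨ cong₂ (λ a l → a + (∑∑ tail + (∑∑ head + l)))
             (∑-transpose (λ u v → 𝟙 (Adj? u v))) (∑-transpose (λ u v → 𝟙 (LoopLeft? u v))) ⟩
      ∑ P (λ u → ∑ P (𝟙 ∘ Adj? u)) + (∑∑ tail + (∑∑ head + ∑ P (λ u → ∑ P (𝟙 ∘ LoopLeft? u))))
        ≤⟨ ℕ.+-mono-≤ (ℕ.≤-reflexive (∑-cong P (λ u → sym (length-filter≡∑ (Adj? u) P))))
             (ℕ.+-mono-≤ (slices SameTail? tail-slice)
               (ℕ.+-mono-≤ (slices SameHead? head-slice) (slices LoopLeft? loop-slice))) ⟩
      energy + (N + (N + N))
        ≡⟨ cong (energy +_) (solve 1 (λ x → x :+ (x :+ x) := con 3 :* x) refl N) ⟩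
      energy + 3 * N ∎
      where
      open ≤-Reasoning
      P : List V²
      P = V²-list
      N : ℕ
      N = n * n * (2 * m)
      ∑∑ : (V² → V² → ℕ) → ℕ
      ∑∑ g = ∑ P (λ e → ∑ P (g e))
      ∑∑-+ : ∀ g h → ∑∑ (λ e f → g e f + h e f) ≡ ∑∑ g + ∑∑ h
      ∑∑-+ g h = trans (∑-cong P (λ e → ∑-+ P (g e) (h e))) (∑-+ P _ _)
      adj tail head loop : V² → V² → ℕ
      adj (u₁ , v₁) (u₂ , v₂) = 𝟙 (Adj? (u₁ , u₂) (v₁ , v₂))
      tail e f = 𝟙 (SameTail? e f)
      head e f = 𝟙 (SameHead? e f)
      loop (u₁ , v₁) (u₂ , v₂) = 𝟙 (LoopLeft? (u₁ , u₂) (v₁ , v₂))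
      pointwise : ∀ e f → 𝟙 (edge-colour f ≟ edge-colour e) ≤ adj e f + (tail e f + (head e f + loop e f))
      pointwise e@(u₁ , v₁) f@(u₂ , v₂) = 𝟙-≤ (κ u₂ v₂ ≟ κ u₁ v₁) (λ eq → cases (equal-colours u₁ v₁ u₂ v₂ eq))
        where
        cases : Adj (u₁ , u₂) (v₁ , v₂) ⊎ SameTail e f ⊎ SameHead e f ⊎ LoopLeft (u₁ , u₂) (v₁ , v₂) →
          1 ≤ adj e f + (tail e f + (head e f + loop e f))
        cases (inj₁ p) = ℕ.≤-trans (𝟙-yes (Adj? (u₁ , u₂) (v₁ , v₂)) p) (ℕ.m≤m+n _ _)
        cases (inj₂ (inj₁ p)) = ℕ.m≤n⇒m≤o+n (adj e f) (ℕ.≤-trans (𝟙-yes (SameTail? e f) p) (ℕ.m≤m+n _ _))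
        cases (inj₂ (inj₂ (inj₁ p))) = ℕ.m≤n⇒m≤o+n (adj e f) (ℕ.m≤n⇒m≤o+n (tail e f)
          (ℕ.≤-trans (𝟙-yes (SameHead? e f) p) (ℕ.m≤m+n _ _)))
        cases (inj₂ (inj₂ (inj₂ p))) = ℕ.m≤n⇒m≤o+n (adj e f) (ℕ.m≤n⇒m≤o+n (tail e f)
          (ℕ.m≤n⇒m≤o+n (head e f) (𝟙-yes (LoopLeft? (u₁ , u₂) (v₁ , v₂)) p)))
      tail-slice : ∀ e → ∃[ f ] ∃[ t ] ∃[ j ] ∀ {y} → SameTail e y → ∃[ w ] y ≡ f w × κ t w ≡ j
      tail-slice (u₁ , v₁) = (u₁ ,_) , u₁ , κ u₁ v₁ , λ { (refl , e) → _ , refl , e }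
      head-slice : ∀ e → ∃[ f ] ∃[ t ] ∃[ j ] ∀ {y} → SameHead e y → ∃[ w ] y ≡ f w × κ t w ≡ j
      head-slice (u₁ , v₁) = (_, v₁) , v₁ , κ v₁ u₁ , λ { (refl , e) → _ , refl , e }
      loop-slice : ∀ u → ∃[ f ] ∃[ t ] ∃[ j ] ∀ {y} → LoopLeft u y → ∃[ w ] y ≡ f w × κ t w ≡ j
      loop-slice (u₁ , u₂) = (u₁ ,_) , u₂ , κ u₁ u₁ , λ { (refl , e) → _ , refl , e }

    -- Energy above `2 * D * (n * n)` would give a subgraph of minimum degree `D` and so
    -- `suc b ^ m ≤ n * n`, against the hypothesis. The energy bound is put into `colour-energy` and
    -- `n * n` cancelled.
    colours-bound : ∀ b → 0 < n → n * n < suc b ^ m →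
      n * n ≤ c * (2 * (suc b + (4 * m) * (4 * m)) + 3 * (2 * m))
    colours-bound b 0<n n²<walks = ℕ.*-cancelʳ-≤ _ _ (n * n) {{>-nonZero (ℕ.*-mono-< 0<n 0<n)}} (begin
      n * n * (n * n)
        ≡⟨ cong (λ l → l * l) length-V² ⟨
      length V²-list * length V²-list
        ≤⟨ colour-energy V²-list edge-colour ⟩
      c * colour-pairs
        ≤⟨ ℕ.*-monoʳ-≤ c colour-pairs≤ ⟩
      c * (energy + 3 * (n * n * (2 * m)))
        ≤⟨ ℕ.*-monoʳ-≤ c (ℕ.+-monoˡ-≤ _ energy≤) ⟩
      c * (2 * D * (n * n) + 3 * (n * n * (2 * m)))
        ≡⟨ solve 4 (λ c d q m → c :* (con 2 :* d :* q :+ con 3 :* (q :* (con 2 :* m)))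
             := c :* (con 2 :* d :+ con 3 :* (con 2 :* m)) :* q) refl c D (n * n) m ⟩
      c * (2 * D + 3 * (2 * m)) * (n * n) ∎)
      where
      open ≤-Reasoning
      D : ℕ
      D = suc b + (4 * m) * (4 * m)
      energy≤ : energy ≤ 2 * D * (n * n)
      energy≤ = ℕ.≮⇒≥ λ large →
        let M , a , a∈M , M! , degree = min-degree-subgraph Adj? (λ {u} {v} → Adj-sym {u} {v}) D
              (length V²-list) ℕ.≤-refl V²-unique
              (subst (λ l → 2 * D * l < energy) (sym length-V²) large)
        in ℕ.<⇒≱ n²<walks (MinDegree.Walks.few-walks M M! b degree a a∈M)

-- Making the colouring symmetric

-- Loops get a colour of their own, so that a loop is never confused with an edge.
symmetrise : ∀ {n c} → EdgeColouring n c → Fin n → Fin n → Fin (suc c)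
symmetrise χ u v with <-cmp u v
... | tri< _ _ _ = suc (χ u v)
... | tri≈ _ _ _ = zero
... | tri> _ _ _ = suc (χ v u)

module _ {n c : ℕ} (χ : EdgeColouring n c) where

  symmetrise-sym : ∀ u v → symmetrise χ u v ≡ symmetrise χ v u
  symmetrise-sym u v with <-cmp u v | <-cmp v u
  ... | tri< _ _ _    | tri> _ _ _    = refl
  ... | tri≈ _ _ _    | tri≈ _ _ _    = refl
  ... | tri> _ _ _    | tri< _ _ _    = refl
  ... | tri< _ _ v≮u  | tri< v<u _ _  = contradiction v<u v≮u
  ... | tri< _ u≢v _  | tri≈ _ v≡u _  = contradiction (sym v≡u) u≢v
  ... | tri≈ _ _ v≮u  | tri< v<u _ _  = contradiction v<u v≮u
  ... | tri≈ u≮v _ _  | tri> _ _ u<v  = contradiction u<v u≮v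
  ... | tri> _ u≢v _  | tri≈ _ v≡u _  = contradiction (sym v≡u) u≢v
  ... | tri> u≮v _ _  | tri> _ _ u<v  = contradiction u<v u≮v

  symmetrise-zero : ∀ {u v} → symmetrise χ u v ≡ zero → u ≡ v
  symmetrise-zero {u} {v} e with tri≈ _ u≡v _ ← <-cmp u v = u≡v

  symmetrise-loop : ∀ {u v w} → symmetrise χ u u ≡ symmetrise χ v w → v ≡ w
  symmetrise-loop {u} e with <-cmp u u
  ... | tri< _ u≢u _ = contradiction refl u≢u
  ... | tri≈ _ _ _   = symmetrise-zero (sym e)
  ... | tri> _ u≢u _ = contradiction refl u≢u

  symmetrise-< : ∀ {u v} → toℕ u < toℕ v → symmetrise χ u v ≡ suc (χ u v)
  symmetrise-< {u} {v} u<v with <-cmp u v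
  ... | tri< _ _ _    = refl
  ... | tri≈ u≮v _ _  = contradiction u<v u≮v
  ... | tri> u≮v _ _  = contradiction u<v u≮v

-- Subsets and lists

insert : ∀ {n} → Fin n → Subset n → Subset n
insert zero    (_ ∷ p) = inside ∷ p
insert (suc i) (s ∷ p) = s ∷ insert i p

insert⁻ : ∀ {n} (i : Fin n) p {j} → j Subset.∈ insert i p → j ≡ i ⊎ j Subset.∈ p
insert⁻ zero    (_ ∷ p) Vec.here = inj₁ refl
insert⁻ zero    (_ ∷ p) (Vec.there j∈) = inj₂ (Vec.there j∈)
insert⁻ (suc i) (_ ∷ p) Vec.here = inj₂ Vec.here
insert⁻ (suc i) (_ ∷ p) (Vec.there j∈) with insert⁻ i p j∈
... | inj₁ refl = inj₁ refl
... | inj₂ j∈p  = inj₂ (Vec.there j∈p)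

∣insert∣ : ∀ {n} (i : Fin n) p → i Subset.∉ p → ∣ insert i p ∣ ≡ suc ∣ p ∣
∣insert∣ zero    (inside ∷ p)  i∉ = contradiction Vec.here i∉
∣insert∣ zero    (outside ∷ p) i∉ = refl
∣insert∣ (suc i) (inside ∷ p)  i∉ = cong suc (∣insert∣ i p (i∉ ∘ Vec.there))
∣insert∣ (suc i) (outside ∷ p) i∉ = ∣insert∣ i p (i∉ ∘ Vec.there)

fromList : ∀ {n} → List (Fin n) → Subset n
fromList = foldr insert Subset.⊥

fromList⁻ : ∀ {n} (xs : List (Fin n)) {i} → i Subset.∈ fromList xs → i ∈ xs
fromList⁻ [] i∈ = contradiction i∈ ∉⊥
fromList⁻ (x ∷ xs) i∈ with insert⁻ x (fromList xs) i∈
... | inj₁ refl = here refl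
... | inj₂ i∈xs = there (fromList⁻ xs i∈xs)

∣fromList∣ : ∀ {n} {xs : List (Fin n)} → Unique xs → ∣ fromList xs ∣ ≡ length xs
∣fromList∣ {n} {[]} _ = ∣⊥∣≡0 n
∣fromList∣ {xs = x ∷ xs} xs!@(_ ∷ xs'!) =
  trans (∣insert∣ x (fromList xs) (Unique[x∷xs]⇒x∉xs xs! ∘ fromList⁻ xs)) (cong suc (∣fromList∣ xs'!))

elements : ∀ {n} → Subset n → List (Fin n)
elements []            = []
elements (inside ∷ p)  = zero ∷ map suc (elements p)
elements (outside ∷ p) = map suc (elements p)

∈-elements⁻ : ∀ {n} (p : Subset n) {i} → i ∈ elements p → i Subset.∈ p
∈-elements⁻ (inside ∷ p) (here refl) = Vec.here
∈-elements⁻ (inside ∷ p) (there i∈) with _ , j∈ , refl ← ∈-map⁻ suc i∈ = Vec.there (∈-elements⁻ p j∈)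
∈-elements⁻ (outside ∷ p) i∈ with _ , j∈ , refl ← ∈-map⁻ suc i∈ = Vec.there (∈-elements⁻ p j∈)

elements-unique : ∀ {n} (p : Subset n) → Unique (elements p)
elements-unique []            = []
elements-unique (inside ∷ p)  =
  unique-∷ (λ z∈ → case ∈-map⁻ suc z∈ of λ ()) (Unique.map⁺ suc-injective (elements-unique p))
elements-unique (outside ∷ p) = Unique.map⁺ suc-injective (elements-unique p)

length-elements : ∀ {n} (p : Subset n) → length (elements p) ≡ ∣ p ∣
length-elements []            = refl
length-elements (inside ∷ p)  = cong suc (trans (length-map suc (elements p)) (length-elements p))
length-elements (outside ∷ p) = trans (length-map suc (elements p)) (length-elements p)

fresh-vertex : ∀ {n} (S : List (Fin n)) → length S < n → ∃[ v ] v ∉ S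
fresh-vertex {n} S S<n with any? (λ v → ¬? (DecMembership._∈?_ _≟_ v S)) (allFin n)
... | yes some with v , _ , v∉S ← find some = v , v∉S
... | no none = contradiction
  (subst (_≤ length S) (length-tabulate (λ (i : Fin n) → i))
    (unique-⊆⇒length≤ (Unique.allFin⁺ n) λ {v} v∈ →
      decidable-stable (DecMembership._∈?_ _≟_ v S) (All.lookup (¬Any⇒All¬ (allFin n) none) v∈)))
  (ℕ.<⇒≱ S<n)

-- Repeated colours in sets of at most k vertices

module _ {n c : ℕ} {χ : EdgeColouring n c} where

  private
    κ = symmetrise χ
    module G = EnergyGraph κ (symmetrise-sym χ) (symmetrise-loop χ)
  open Repeats κ

  -- The colouring condition is about exactly `k` vertices; smaller sets are filled up, which cannot
  -- lower `reps`.
  pad : ∀ {k} fuel S → k ≤ n → fuel + length S ≡ k → Unique S →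
    ∃[ S′ ] Unique S′ × length S′ ≡ k × reps S ≤ reps S′
  pad zero S _ l S! = S , S! , l , ℕ.≤-refl
  pad (suc fuel) S k≤n l S!
    with v , v∉S ← fresh-vertex S (ℕ.≤-trans (s≤s (ℕ.m≤n+m (length S) fuel)) (ℕ.≤-trans (ℕ.≤-reflexive l) k≤n))
    with S′ , S′! , l′ , r ← pad fuel (v ∷ S) k≤n (trans (ℕ.+-suc fuel (length S)) l) (unique-∷ v∉S S!)
    = S′ , S′! , l′ , ℕ.≤-trans (reps-∷ v S) r

  -- Were `reps S′` at least `k / 2`, the colours on the `k` points would fit in a list of length
  -- `k C 2 ∸ k / 2`, one less than `ellThm k`. The shift `suc` turns colours of `χ` into colours of
  -- `κ`.
  few-repeats : ∀ {k} → IsKLColouring k (ellThm k) χ → k ≤ n →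
    ∀ {S} → Unique S → length S ≤ k → reps S < k / 2
  few-repeats {k} kl k≤n {S} S! S≤k
    with S′ , S′! , l , r ← pad (k ∸ length S) S k≤n (ℕ.m∸n+n≡m S≤k) S!
    with T , ℓ≤T , appears ← kl (fromList S′) (trans (∣fromList∣ S′!) l)
    with ts , total , cover ← colours-cover S′ = ℕ.≤-<-trans r (ℕ.≰⇒> λ many →
      ℕ.<⇒≱ (ℕ.≤-trans (ℕ.≤-reflexive (sym (ℕ.+-comm _ 1))) ℓ≤T) (begin
        ∣ T ∣                           ≡⟨ length-elements T ⟨
        length (elements T)             ≡⟨ length-map suc (elements T) ⟨
        length (map suc (elements T))   ≤⟨ unique-⊆⇒length≤ (Unique.map⁺ suc-injective (elements-unique T)) (sub S′ T appears cover) ⟩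
        length ts                       ≤⟨ ℕ.m+n≤o⇒m≤o∸n (length ts) (ℕ.≤-trans (ℕ.+-monoʳ-≤ (length ts) many)
                                             (ℕ.≤-reflexive (trans total (cong (_C 2) l)))) ⟩
        k C 2 ∸ k / 2                   ∎))
    where
    open ≤-Reasoning
    sub : ∀ {ts} S T → (∀ j → j Subset.∈ T → AppearsIn χ (fromList S) j) → colours S ⊆ ts →
      map suc (elements T) ⊆ ts
    sub S T appears cover i∈ with j , j∈ , refl ← ∈-map⁻ suc i∈
      with u , v , u∈S , v∈S , u<v , refl ← appears j (∈-elements⁻ T j∈) =
        cover (subst (_∈ colours S) (symmetrise-< χ u<v)
          (G.colours-∈ (fromList⁻ S u∈S) (fromList⁻ S v∈S) λ { refl → ℕ.<-irrefl refl u<v }))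

-- Roots, constants and exponents

*-^ : ∀ t x y → (x * y) ^ t ≡ x ^ t * y ^ t
*-^ zero    x y = refl
*-^ (suc t) x y = trans (cong (x * y *_) (*-^ t x y))
  (solve 4 (λ x y a b → x :* y :* (a :* b) := x :* a :* (y :* b)) refl x y (x ^ t) (y ^ t))
  where open +-*-Solver

-- `b` is the integer part of the root, and grows by at most one when `x` does. For `x = n * n` the
-- upper bound excludes branching `suc b`, and the lower one lets `b` be eliminated at the end.
floor-root : ∀ m x → ∃[ b ] b ^ suc m ≤ x × x < suc b ^ suc m
floor-root m zero = 0 , z≤n , ℕ.m^n>0 1 (suc m)
floor-root m (suc x) with b , lower , upper ← floor-root m x with suc x ℕ.<? suc b ^ suc m
... | yes x+1<  = b , ℕ.m≤n⇒m≤1+n lower , x+1<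
... | no  x+1≮  = suc b , ℕ.≮⇒≥ x+1≮ , ℕ.≤-<-trans upper (ℕ.^-monoˡ-< (suc m) (ℕ.n<1+n (suc b)))

-- As `c` and `b` are positive, `suc c ≤ c + c` absorbs the extra loop colour, and constant terms
-- are at most their multiples by `b`.
absorb-constants : ∀ {x c b} q r → 0 < c → 0 < b → x ≤ suc c * (2 * (suc b + q) + r) →
  x ≤ 2 * (4 + 2 * q + r) * c * b
absorb-constants {x} {c} {b} q r 0<c 0<b x≤ = begin
  x                                        ≤⟨ x≤ ⟩
  suc c * (2 * (suc b + q) + r)            ≤⟨ ℕ.*-mono-≤ (ℕ.+-monoˡ-≤ c 0<c) (factor 0<b) ⟩
  (c + c) * ((4 + 2 * q + r) * b)          ≡⟨ solve 3 (λ c e b → (c :+ c) :* (e :* b) := con 2 :* e :* c :* b)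
                                                refl c (4 + 2 * q + r) b ⟩
  2 * (4 + 2 * q + r) * c * b              ∎
  where
  open ≤-Reasoning
  open +-*-Solver
  factor : ∀ {b} → 0 < b → 2 * (suc b + q) + r ≤ (4 + 2 * q + r) * b
  factor (s≤s {n = b} _) = ℕ.≤-trans (ℕ.m≤m+n _ ((2 + 2 * q + r) * b)) (ℕ.≤-reflexive
    (solve 3 (λ q r b → con 2 :* (con 2 :+ b :+ q) :+ r :+ (con 2 :+ con 2 :* q :+ r) :* b
      := (con 4 :+ con 2 :* q :+ r) :* (con 1 :+ b)) refl q r b))

-- With `k = suc m * 4` this is the `k`-th power of `c = Ω(n^(2 - 8/k))`, free of roots. Raise the
-- linear bound to the power `suc m`, replace `b ^ suc m` by `n * n`, cancel `n * n` and take fourth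
-- powers.
raise : ∀ m {n b} a c → 0 < n → b ^ suc m ≤ n * n → n * n ≤ a * c * b →
  n ^ (2 * (suc m * 4) ∸ 8) ≤ a ^ (suc m * 4) * c ^ (suc m * 4)
raise m {n} {b} a c 0<n root linear = begin
  -- Since `suc m * 4` is `4 + m * 4`, the exponent is `2 * (m * 4)`.
  n ^ (2 * (suc m * 4) ∸ 8)             ≡⟨ cong (λ e → n ^ (e ∸ 8)) (ℕ.*-distribˡ-+ 2 4 (m * 4)) ⟩
  n ^ (2 * (m * 4))                     ≡⟨ ℕ.^-*-assoc n 2 (m * 4) ⟨
  (n ^ 2) ^ (m * 4)                     ≡⟨ cong (λ x → (n * x) ^ (m * 4)) (ℕ.*-identityʳ n) ⟩
  (n * n) ^ (m * 4)                     ≡⟨ ℕ.^-*-assoc (n * n) m 4 ⟨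
  ((n * n) ^ m) ^ 4                     ≤⟨ ℕ.^-monoˡ-≤ 4 (ℕ.*-cancelˡ-≤ (n * n) {{>-nonZero (ℕ.*-mono-< 0<n 0<n)}} power) ⟩
  ((a * c) ^ suc m) ^ 4                 ≡⟨ ℕ.^-*-assoc (a * c) (suc m) 4 ⟩
  (a * c) ^ (suc m * 4)                 ≡⟨ *-^ (suc m * 4) a c ⟩
  a ^ (suc m * 4) * c ^ (suc m * 4)     ∎
  where
  open ≤-Reasoning
  power : n * n * (n * n) ^ m ≤ n * n * (a * c) ^ suc m
  power = begin
    (n * n) ^ suc m                     ≤⟨ ℕ.^-monoˡ-≤ (suc m) linear ⟩
    (a * c * b) ^ suc m                 ≡⟨ *-^ (suc m) (a * c) b ⟩
    (a * c) ^ suc m * b ^ suc m         ≤⟨ ℕ.*-monoʳ-≤ ((a * c) ^ suc m) root ⟩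
    (a * c) ^ suc m * (n * n)           ≡⟨ ℕ.*-comm ((a * c) ^ suc m) (n * n) ⟩
    n * n * (a * c) ^ suc m             ∎

constant : ℕ → ℕ
constant m = 2 * (4 + 2 * ((4 * m) * (4 * m)) + 3 * (2 * m))

linear-bound : ∀ m {n c} (χ : EdgeColouring n c) b → 0 < m → 0 < n → 0 < c → 0 < b →
  m * 4 ≤ n → IsKLColouring (m * 4) (ellThm (m * 4)) χ → n * n < suc b ^ m →
  n * n ≤ constant m * c * b
linear-bound m χ b 0<m 0<n 0<c 0<b k≤n kl upper =
  absorb-constants ((4 * m) * (4 * m)) (3 * (2 * m)) 0<c 0<b (F.colours-bound b 0<n upper)
  where
  open +-*-Solver
  k/2 : (m * 4) / 2 ≡ 2 * m
  k/2 = trans (cong (_/ 2) (solve 1 (λ m → m :* con 4 := con 2 :* m :* con 2) refl m)) (m*n/n≡m (2 * m) 2)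
  module G = EnergyGraph (symmetrise χ) (symmetrise-sym χ) (symmetrise-loop χ)
  module F = G.FewRepeats m 0<m (λ S! l →
    ℕ.<-≤-trans (few-repeats {χ = χ} kl k≤n S! (ℕ.≤-trans l (ℕ.≤-reflexive (ℕ.*-comm 4 m))))
      (ℕ.≤-reflexive k/2))

theorem1p2 : ∀ (k : ℕ) → 8 ≤ k → 4 ∣ k →
    ∃[ d ] ∃[ N ] ∀ (n : ℕ) → N ≤ n → ∀ (c : ℕ) (χ : EdgeColouring n c) →
    IsKLColouring k (ellThm k) χ → n ^ (2 * k ∸ 8) ≤ d * c ^ k
theorem1p2 _ () (divides zero refl)
-- `d` is the `k`-th power of the linear constant; `n ≥ k` allows small sets to be filled up to `k`
-- vertices.
theorem1p2 _ _ (divides (suc m) refl) = constant (suc m) ^ (suc m * 4) , suc m * 4 , bound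
  where
  colour-exists : ∀ {n c} → EdgeColouring n c → Fin n → 0 < c
  colour-exists {c = suc _} _ _ = s≤s z≤n
  colour-exists {c = zero}  χ v with () ← χ v v
  positive : ∀ {x} b → 0 < x → x < suc b ^ suc m → 0 < b
  positive zero    0<x x<1 = contradiction 0<x (ℕ.<⇒≱ (ℕ.<-≤-trans x<1 (ℕ.≤-reflexive (ℕ.^-zeroˡ (suc m)))))
  positive (suc _) _   _   = s≤s z≤n
  bound : ∀ n → suc m * 4 ≤ n → ∀ c (χ : EdgeColouring n c) →
    IsKLColouring (suc m * 4) (ellThm (suc m * 4)) χ →
    n ^ (2 * (suc m * 4) ∸ 8) ≤ constant (suc m) ^ (suc m * 4) * c ^ (suc m * 4)
  bound n k≤n c χ kl with b , root , upper ← floor-root m (n * n) =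
    raise m (constant (suc m)) c 0<n root
      (linear-bound (suc m) χ b (s≤s z≤n) 0<n (colour-exists χ (fromℕ< 0<n))
        (positive b (ℕ.*-mono-< 0<n 0<n) upper) k≤n kl upper)
    where
    0<n : 0 < n
    0<n = ℕ.≤-trans (s≤s z≤n) k≤n
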